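{- For any integer $s\geq 3$, $$CR(s,3)=\begin{cases}2\cdot 5^{\frac{s-3}{2}}+1 & \text{if } s \text{ is odd},\\ 5^{\frac{s-2}{2}}+1 & \text{if } s \text{ is even}.\end{cases}$$
   Context: An edge-colored $s$-vertex graph $G$ with edge-coloring $\chi$ is called orderable if there exist an ordering $(v_1,\ldots,v_s)$ of $V(G)$ and a list $(c_1,\ldots,c_{s-1})$ of not necessarily distinct colors such that for every edge $v_iv_j\in E(G)$ with $i<j$ we have $\chi(v_iv_j)=c_i$. An edge-colored graph is rainbow if all its edges have pairwise different colors. For positive integers $s,t$, $CR(s,t)$ is the minimum integer $n$ such that every edge-coloring of $K_n$ with any number of colors contains either an orderable copy of $K_s$ or a rainbow copy of $K_t$ (copies carry the inherited coloring). -}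

module Defs where

open import Data.Fin.Base using (Fin; _<_; fromℕ<)
open import Data.Fin.Permutation using (Permutation′; _⟨$⟩ʳ_)
open import Data.Fin.Properties using (toℕ≤pred[n])
open import Data.Nat.Base as ℕ using (ℕ; pred)
open import Data.Nat.Properties using (<-≤-trans)
open import Data.Product.Base using (Σ-syntax; ∃-syntax; _×_)
open import Data.Sum.Base using (_⊎_)
open import Data.Vec.Base using (Vec; lookup)
open import Function.Bundles using (_↣_; Injection)
open import Relation.Binary.Definitions using (Symmetric; Irreflexive)
open import Relation.Binary.PropositionalEquality using (_≡_; _≢_; ≢-sym)
open import Relation.Nullary.Negation using (¬_)

record Graph (n : ℕ) : Set₁ where
  field
    Adj    : Fin n → Fin n → Set
    sym    : Symmetric Adj
    irrefl : Irreflexive _≡_ Adj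

complete : (n : ℕ) → Graph n
complete n = record
  { Adj    = _≢_
  ; sym    = ≢-sym
  ; irrefl = λ i≡j i≢j → i≢j i≡j
  }

-- Applying `undirected` twice also shows that a colour does not depend on
-- the proof of adjacency, so this is a function on unordered edges.
record EdgeColoring {n : ℕ} (G : Graph n) (C : Set) : Set where
  open Graph G
  field
    color      : ∀ {u v} → Adj u v → C
    undirected : ∀ {u v} (e : Adj u v) (e′ : Adj v u) → color e ≡ color e′

record Copy {m n : ℕ} (H : Graph m) (G : Graph n) : Set where
  field
    embed     : Fin m ↣ Fin n
    preserves : ∀ {u v} → Graph.Adj H u v →
                Graph.Adj G (Injection.to embed u) (Injection.to embed v)

inherited : {m n : ℕ} {H : Graph m} {G : Graph n} {C : Set} →
            EdgeColoring G C → Copy H G → EdgeColoring H C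
inherited χ K = record
  { color      = λ e → color (preserves e)
  ; undirected = λ e e′ → undirected (preserves e) (preserves e′)
  }
  where
  open EdgeColoring χ
  open Copy K

-- With 0-based indices, the list of s − 1 colours is indexed by the first
-- s − 1 positions; i < j guarantees that i is one of them.
position : {s : ℕ} {i j : Fin s} → i < j → Fin (pred s)
position {j = j} i<j = fromℕ< (<-≤-trans i<j (toℕ≤pred[n] j))

Orderable : {s : ℕ} {G : Graph s} {C : Set} → EdgeColoring G C → Set
Orderable {s} {G} {C} χ =
  Σ[ v ∈ Permutation′ s ] Σ[ c ∈ Vec C (pred s) ]
    (∀ {i j} (i<j : i < j) (e : Adj (v ⟨$⟩ʳ i) (v ⟨$⟩ʳ j)) →
      color e ≡ lookup c (position i<j))
  where
  open Graph G
  open EdgeColoring χ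

SameEdge : {n : ℕ} (u v x y : Fin n) → Set
SameEdge u v x y = (u ≡ x × v ≡ y) ⊎ (u ≡ y × v ≡ x)

Rainbow : {n : ℕ} {G : Graph n} {C : Set} → EdgeColoring G C → Set
Rainbow {G = G} χ =
  ∀ {u v x y} (e : Adj u v) (e′ : Adj x y) →
    ¬ SameEdge u v x y → color e ≢ color e′
  where
  open Graph G
  open EdgeColoring χ

-- The number k of available colours is arbitrary, and not all of them have
-- to be used.
Forces : (s t n : ℕ) → Set
Forces s t n =
  (k : ℕ) (χ : EdgeColoring (complete n) (Fin k)) →
    (∃[ K ] Orderable (inherited {H = complete s} χ K)) ⊎
    (∃[ K ] Rainbow (inherited {H = complete t} χ K))

-- CR(s,t) = n.  Letting n range over ℕ rather than the integers or the
-- positive integers is harmless: for s, t ≥ 1 the empty graph contains no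
-- copy of K_s or K_t.
IsCR : (s t n : ℕ) → Set
IsCR s t n = Forces s t n × (∀ m → Forces s t m → n ℕ.≤ m)

{-# OPTIONS --safe #-}
module Submission where

-- Colourings without rainbow triangles have Gallai partitions: for two
-- suitable colours a, b the components of the graph of all other colours are
-- blocks such that all edges between two blocks have the same colour, a or b.
--
-- Upper bound, by induction on the length s of a longest ordering, the maximal
-- orders being q, 2q, 5q, 10q for s = 2t+1, 2t+2, 2t+3, 2t+4, where q = 5^t.
-- A block admits only orderings of length s − 2, unless the colouring splits
-- into two parts joined by a single colour, and a monochromatic neighbourhood
-- only those of length s − 1.  For odd s a block and its two neighbourhoods
-- then have at most q + 2q + 2q vertices.  For even s and more than 10q
-- vertices, all blocks turn out to have at most q vertices, and two blocks
-- together more than q.  Hence every block has at least 5 neighbouring blocks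
-- of either colour; 6 of them would contain a cherry inside two nested
-- neighbourhoods, whose ends would be two blocks with together at most q
-- vertices.  So there are 11 blocks and colour a is 5-regular on them, which
-- contradicts parity.
--
-- Lower bound: substituting a colouring into the vertices of the pentagon
-- colouring of K₅ increases the longest ordering by 2 only.

open import Defs
open import Data.Bool.Base using (Bool; true; false; not)
open import Data.Empty using (⊥; ⊥-elim)
open import Data.Fin.Base as Fin using (Fin; zero; suc; toℕ; fromℕ<; inject₁; inject≤; remQuot; combine)
open import Data.Fin.Permutation as Permutation using (_⟨$⟩ʳ_)
import Data.Fin.Properties as Fin
open import Data.List.Base using (List; []; _∷_; length; filter; map; tabulate)
open import Data.List.Membership.Propositional using (_∈_; find; lose)
open import Data.List.Membership.Propositional.Properties using (∈-filter⁺; ∈-filter⁻)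
open import Data.List.Properties using (filter-all; length-map; length-tabulate)
open import Data.List.Relation.Binary.Subset.Propositional using (_⊆_)
open import Data.List.Relation.Unary.All as All using (All; []; _∷_; all?)
import Data.List.Relation.Unary.All.Properties as All
open import Data.List.Relation.Unary.AllPairs as AllPairs using (AllPairs; []; _∷_)
import Data.List.Relation.Unary.AllPairs.Properties as AllPairs
open import Data.List.Relation.Unary.Any using (here; there; any?)
open import Data.List.Relation.Unary.Unique.Propositional using (Unique)
import Data.List.Relation.Unary.Unique.Propositional.Properties as Unique
open import Data.Nat.Base
  using (ℕ; zero; suc; pred; _+_; _*_; _∸_; _^_; _≤_; _<_; z≤n; s≤s; ∣_-_∣)
open import Data.Nat.DivMod using (_/_; _%_; m≡m%n+[m/n]*n; m%n<n)
open import Data.Nat.Divisibility using (_∣_; _∤_; divides; ∣m+n∣m⇒∣n; n∣m⇒m%n≡0; ∣-refl)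
open import Data.Nat.Properties as ℕ hiding (_≟_)
open import Data.Nat.Tactic.RingSolver using (solve-∀)
open import Data.Product.Base using (Σ-syntax; ∃; ∃-syntax; _×_; _,_; proj₁; proj₂)
open import Data.Sum.Base using (_⊎_; inj₁; inj₂; [_,_]′)
open import Data.Vec.Base as Vec using (Vec; []; _∷_; toList; fromList; lookup)
open import Data.Vec.Membership.Propositional.Properties using (∈-lookup; ∈-toList⁺)
open import Data.Vec.Properties using (toList∘fromList; lookup∘tabulate)
open import Function.Base using (_∘_; id)
open import Function.Bundles using (Injection; Inverse; mk↣)
open import Relation.Binary.Definitions using (DecidableEquality; tri<; tri≈; tri>)
open import Relation.Binary.PropositionalEquality
  using (_≡_; _≢_; refl; sym; trans; cong; cong₂; subst; ≢-sym)
open import Relation.Nullary.Decidable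
  using (Dec; yes; no; ¬?; _×-dec_; _⊎-dec_; _→-dec_; from-yes; map′; toSum)
open import Relation.Nullary.Negation using (¬_)
open import Relation.Unary using (Decidable)

-- Counting in lists and degree sums.

module _ {A : Set} {P Q : A → Set} (P? : Decidable P) (Q? : Decidable Q) where

  length-filter-⊎ : ∀ xs → length (filter (λ x → P? x ⊎-dec Q? x) xs) ≤
    length (filter P? xs) + length (filter Q? xs)
  length-filter-⊎ [] = z≤n
  length-filter-⊎ (x ∷ xs) with P? x | Q? x | length-filter-⊎ xs
  ... | yes _ | yes _ | ih = s≤s (≤-trans ih (+-monoʳ-≤ _ (n≤1+n _)))
  ... | yes _ | no _  | ih = s≤s ih
  ... | no _  | yes _ | ih = ≤-trans (s≤s ih) (≤-reflexive (sym (+-suc _ _)))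
  ... | no _  | no _  | ih = ih

  length≤filter+filter : ∀ xs → (∀ {x} → x ∈ xs → P x ⊎ Q x) →
    length xs ≤ length (filter P? xs) + length (filter Q? xs)
  length≤filter+filter xs cover = ≤-trans
    (≤-reflexive (cong length (sym (filter-all _ (All.tabulate cover)))))
    (length-filter-⊎ xs)

0<length⇒∃∈ : {A : Set} {xs : List A} → 0 < length xs → ∃[ x ] x ∈ xs
0<length⇒∃∈ {xs = x ∷ _} _ = x , here refl

module Symmetric {A : Set} {D : A → A → Set} (D? : ∀ x y → Dec (D x y))
  (D-sym : ∀ {x y} → D x y → D y x) (D-irrefl : ∀ {x} → ¬ D x x) where

  degree : List A → A → ℕ
  degree xs x = length (filter (D? x) xs)

  degrees : List A → List A → ℕ
  degrees []       ys = 0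
  degrees (x ∷ xs) ys = degree ys x + degrees xs ys

  degrees-∷ʳ : ∀ y xs ys → degrees xs (y ∷ ys) ≡ degree xs y + degrees xs ys
  degrees-∷ʳ y []       ys = refl
  degrees-∷ʳ y (x ∷ xs) ys rewrite degrees-∷ʳ y xs ys with D? x y | D? y x
  ... | yes _ | yes _ = cong suc (lemma (degree ys x) (degree xs y) (degrees xs ys))
    where
    lemma : ∀ a b c → a + (b + c) ≡ b + (a + c)
    lemma = solve-∀
  ... | no _  | no _  = lemma (degree ys x) (degree xs y) (degrees xs ys)
    where
    lemma : ∀ a b c → a + (b + c) ≡ b + (a + c)
    lemma = solve-∀
  ... | yes d | no ¬d = ⊥-elim (¬d (D-sym d))
  ... | no ¬d | yes d = ⊥-elim (¬d (D-sym d))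

  -- Adding `x` adds its row and its column. By symmetry each contributes `degree xs x`, and
  -- irreflexivity removes the diagonal entry.
  handshake : ∀ xs → ∃[ e ] degrees xs xs ≡ e + e
  handshake [] = 0 , refl
  handshake (x ∷ xs) with handshake xs
  ... | e , eq rewrite degrees-∷ʳ x xs xs | eq with D? x x
  ...   | yes d = ⊥-elim (D-irrefl d)
  ...   | no _  = degree xs x + e , lemma (degree xs x) e
    where
    lemma : ∀ a e → a + (a + (e + e)) ≡ a + e + (a + e)
    lemma = solve-∀

  degrees-regular : ∀ {d} xs ys → (∀ {x} → x ∈ xs → degree ys x ≡ d) →
    degrees xs ys ≡ length xs * d
  degrees-regular [] ys _ = refl
  degrees-regular (x ∷ xs) ys eq = cong₂ _+_ (eq (here refl)) (degrees-regular xs ys (eq ∘ there))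

-- Connected components as labellings.

module Components {V : Set} (_≟_ : DecidableEquality V) {E : V → V → Set}
  (E? : ∀ x y → Dec (E x y)) (E-sym : ∀ {x y} → E x y → E y x) where

  Invariant : (V → ℕ) → List V → Set
  Invariant f S = ∀ {x y} → x ∈ S → y ∈ S → E x y → f x ≡ f y

  -- The universal property says that two vertices with equal labels are
  -- connected inside S.
  record Labelling (S : List V) : Set where
    field
      ℓ         : V → ℕ
      invariant : Invariant ℓ S
      universal : ∀ f → Invariant f S → ∀ {x y} → x ∈ S → y ∈ S → ℓ x ≡ ℓ y → f x ≡ f y

  -- Vertices are added one at a time. The old components with an edge to `v` merge with `v` under
  -- the label 0; the others keep their labels, shifted by one to stay clear of 0.
  labelling : ∀ S → Labelling S
  labelling [] = record { ℓ = λ _ → 0 ; invariant = λ () ; universal = λ _ _ () }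
  labelling (v ∷ S) = record { ℓ = ℓ′ ; invariant = invariant′ ; universal = universal′ }
    where
    open Labelling (labelling S)

    Joins : V → Set
    Joins x = x ≡ v ⊎ ∃[ w ] (w ∈ S × ℓ w ≡ ℓ x × E v w)

    joins? : ∀ x → Dec (Joins x)
    joins? x with x ≟ v | any? (λ w → (ℓ w ℕ.≟ ℓ x) ×-dec E? v w) S
    ... | yes p | _     = yes (inj₁ p)
    ... | no _  | yes a = yes (inj₂ (find a))
    ... | no ¬p | no ¬a = no λ { (inj₁ p) → ¬p p ; (inj₂ (w , w∈ , q)) → ¬a (lose w∈ q) }

    ℓ′ : V → ℕ
    ℓ′ x with joins? x
    ... | yes _ = 0
    ... | no _  = suc (ℓ x)

    joins-resp : ∀ {x y} → x ∈ v ∷ S → y ∈ v ∷ S → E x y → Joins x → Joins y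
    joins-resp _ (here refl) _ _ = inj₁ refl
    joins-resp _ (there y∈) e (inj₁ refl) = inj₂ (_ , y∈ , refl , e)
    joins-resp (here refl) (there y∈) e (inj₂ _) = inj₂ (_ , y∈ , refl , e)
    joins-resp (there x∈) (there y∈) e (inj₂ (w , w∈ , eq , e′)) =
      inj₂ (w , w∈ , trans eq (invariant x∈ y∈ e) , e′)

    invariant′ : Invariant ℓ′ (v ∷ S)
    invariant′ {x} {y} x∈ y∈ e with joins? x | joins? y
    ... | yes _ | yes _ = refl
    ... | yes p | no ¬q = ⊥-elim (¬q (joins-resp x∈ y∈ e p))
    ... | no ¬p | yes q = ⊥-elim (¬p (joins-resp y∈ x∈ (E-sym e) q))
    invariant′ (here refl) _ _ | no ¬p | no _ = ⊥-elim (¬p (inj₁ refl))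
    invariant′ (there _) (here refl) _ | no _ | no ¬q = ⊥-elim (¬q (inj₁ refl))
    invariant′ (there x∈) (there y∈) e | no _ | no _ = cong suc (invariant x∈ y∈ e)

    universal′ : ∀ f → Invariant f (v ∷ S) → ∀ {x y} → x ∈ v ∷ S → y ∈ v ∷ S →
      ℓ′ x ≡ ℓ′ y → f x ≡ f y
    universal′ f inv {x} {y} x∈ y∈ eq with joins? x | joins? y
    ... | yes p | yes q = trans (to-v x∈ p) (sym (to-v y∈ q))
      where
      to-v : ∀ {z} → z ∈ v ∷ S → Joins z → f z ≡ f v
      to-v _ (inj₁ refl) = refl
      to-v (here refl) (inj₂ _) = refl
      -- `z` shares its old label with a vertex `w` adjacent to `v`, so `f z`, `f w` and `f v`
      -- agree.
      to-v (there z∈) (inj₂ (w , w∈ , ℓw≡ℓz , e)) = trans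
        (universal f (λ p q → inv (there p) (there q)) z∈ w∈ (sym ℓw≡ℓz))
        (sym (inv (here refl) (there w∈) e))
    universal′ f inv (here refl) _ _ | no ¬p | no _ = ⊥-elim (¬p (inj₁ refl))
    universal′ f inv (there _) (here refl) _ | no _ | no ¬q = ⊥-elim (¬q (inj₁ refl))
    universal′ f inv (there x∈) (there y∈) eq | no _ | no _ =
      universal f (λ p q → inv (there p) (there q)) x∈ y∈ (suc-injective eq)

-- Gallai partitions.

NoRainbowTriangle : {V : Set} → (V → V → ℕ) → Set
NoRainbowTriangle χ = ∀ x y z → χ x y ≡ χ x z ⊎ χ x y ≡ χ y z ⊎ χ x z ≡ χ y z

module GallaiPartition {V : Set} (_≟_ : DecidableEquality V) (χ : V → V → ℕ)
  (χ-sym : ∀ x y → χ x y ≡ χ y x) (gallai : NoRainbowTriangle χ) where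

  -- The blocks are the fibres of `ℓ`. The two palette colours may coincide, as they do on two
  -- vertices.
  record Partition (S : List V) : Set where
    field
      ℓ           : V → ℕ
      palette     : Bool → ℕ
      bicoloured  : ∀ {x y} → x ∈ S → y ∈ S → ℓ x ≢ ℓ y → ∃[ β ] χ x y ≡ palette β
      homogeneous : ∀ {x y z} → x ∈ S → y ∈ S → z ∈ S → ℓ y ≡ ℓ z → ℓ x ≢ ℓ y → χ x y ≡ χ x z
      proper      : ∃[ x ] ∃[ y ] x ∈ S × y ∈ S × ℓ x ≢ ℓ y

  Other : ℕ → ℕ → V → V → Set
  Other a b x y = χ x y ≢ a × χ x y ≢ b

  other? : ∀ a b x y → Dec (Other a b x y)
  other? a b x y = ¬? (χ x y ℕ.≟ a) ×-dec ¬? (χ x y ℕ.≟ b)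

  other-sym : ∀ {a b x y} → Other a b x y → Other a b y x
  other-sym {x = x} {y} = subst (λ c → c ≢ _ × c ≢ _) (χ-sym x y)

  ¬other : ∀ {a b x y} → ¬ Other a b x y → χ x y ≡ a ⊎ χ x y ≡ b
  ¬other {a} {b} {x} {y} ¬o with χ x y ℕ.≟ a | χ x y ℕ.≟ b
  ... | yes p | _     = inj₁ p
  ... | no _  | yes q = inj₂ q
  ... | no ¬p | no ¬q = ⊥-elim (¬o (¬p , ¬q))

  -- A labelling that is constant along the edges of other colours but not on `S` certifies
  -- disconnectedness without mentioning paths.
  Disconnected : ℕ → ℕ → List V → Set
  Disconnected a b S = Σ[ f ∈ (V → ℕ) ] (∀ {x y} → x ∈ S → y ∈ S → Other a b x y → f x ≡ f y) ×
    ∃[ x ] ∃[ y ] x ∈ S × y ∈ S × f x ≢ f y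

  -- The components of the graph of all colours other than a and b.
  module Split (a b : ℕ) (S : List V) where
    open Components _≟_ (other? a b) other-sym
    open Labelling (labelling S) public

    two-coloured : ∀ {x y} → x ∈ S → y ∈ S → ℓ x ≢ ℓ y → χ x y ≡ a ⊎ χ x y ≡ b
    two-coloured x∈ y∈ ≁ = ¬other (≁ ∘ invariant x∈ y∈)

    -- The colour of xy, as a function of y, is invariant off the component of x.
    module _ {x : V} (x∈ : x ∈ S) where
      f : V → ℕ
      f y with ℓ x ℕ.≟ ℓ y
      ... | yes _ = 0
      ... | no _  = χ x y

      f-invariant : Invariant f S
      f-invariant {y} {z} y∈ z∈ o with ℓ x ℕ.≟ ℓ y | ℓ x ℕ.≟ ℓ z
      ... | yes _ | yes _ = refl
      ... | yes p | no ¬q = ⊥-elim (¬q (trans p (invariant y∈ z∈ o)))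
      ... | no ¬p | yes q = ⊥-elim (¬p (trans q (sym (invariant y∈ z∈ o))))
      -- The colours of `xy` and `xz` are among `a`, `b` and that of `yz` is not, so only
      -- `χ x y ≡ χ x z` survives.
      ... | no ¬p | no ¬q with gallai x y z | two-coloured x∈ y∈ ¬p | two-coloured x∈ z∈ ¬q
      ...   | inj₁ eq | _ | _ = eq
      ...   | inj₂ (inj₁ eq) | inj₁ e | _ = ⊥-elim (proj₁ o (trans (sym eq) e))
      ...   | inj₂ (inj₁ eq) | inj₂ e | _ = ⊥-elim (proj₂ o (trans (sym eq) e))
      ...   | inj₂ (inj₂ eq) | _ | inj₁ e = ⊥-elim (proj₁ o (trans (sym eq) e))
      ...   | inj₂ (inj₂ eq) | _ | inj₂ e = ⊥-elim (proj₂ o (trans (sym eq) e))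

      uniform : ∀ {y z} → y ∈ S → z ∈ S → ℓ y ≡ ℓ z → ℓ x ≢ ℓ y → χ x y ≡ χ x z
      uniform {y} {z} y∈ z∈ y~z x≁y
        with ℓ x ℕ.≟ ℓ y | ℓ x ℕ.≟ ℓ z | universal f f-invariant y∈ z∈ y~z
      ... | yes p | _     | _  = ⊥-elim (x≁y p)
      ... | no _  | yes q | _  = ⊥-elim (x≁y (trans q (sym y~z)))
      ... | no _  | no _  | eq = eq

    separated : Disconnected a b S → ∃[ x ] ∃[ y ] x ∈ S × y ∈ S × ℓ x ≢ ℓ y
    separated (g , inv , x , y , x∈ , y∈ , gx≢gy) =
      x , y , x∈ , y∈ , gx≢gy ∘ universal g inv x∈ y∈

  isolated⇒disconnected : ∀ {a b v w S} → Unique (v ∷ S) → w ∈ S →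
    (∀ {y} → y ∈ S → ¬ Other a b v y) → Disconnected a b (v ∷ S)
  isolated⇒disconnected {a} {b} {v} {w} {S} (v∉S ∷ _) w∈ iso =
    δ , δ-invariant , v , w , here refl , there w∈ , δv≢δw
    where
    δ : V → ℕ
    δ y with y ≟ v
    ... | yes _ = 1
    ... | no _  = 0

    δ-invariant : ∀ {x y} → x ∈ v ∷ S → y ∈ v ∷ S → Other a b x y → δ x ≡ δ y
    δ-invariant (here refl) (here refl) _ = refl
    δ-invariant (here refl) (there y∈) o = ⊥-elim (iso y∈ o)
    δ-invariant (there x∈) (here refl) o = ⊥-elim (iso x∈ (other-sym o))
    δ-invariant {x} {y} (there x∈) (there y∈) o with x ≟ v | y ≟ v
    ... | yes refl | _        = ⊥-elim (All.lookup v∉S x∈ refl)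
    ... | no _     | yes refl = ⊥-elim (All.lookup v∉S y∈ refl)
    ... | no _     | no _     = refl

    δv≢δw : δ v ≢ δ w
    δv≢δw with v ≟ v | w ≟ v
    ... | no ¬p | _        = ⊥-elim (¬p refl)
    ... | yes _ | yes refl = ⊥-elim (All.lookup v∉S w∈ refl)
    ... | yes _ | no _     = λ ()

  module Extend {v : V} {S : List V} (v∷S! : Unique (v ∷ S)) {a b : ℕ}
    (disc : Disconnected a b S) where
    open Split a b S

    Attached : V → V → Set
    Attached x y = ℓ y ≡ ℓ x × Other a b v y

    attached? : ∀ x y → Dec (Attached x y)
    attached? x y = (ℓ y ℕ.≟ ℓ x) ×-dec other? a b v y

    -- A component that receives no edge of other colours from `v` stays a component after `v` is
    -- added, so its indicator function disconnects `v ∷ S`.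
    detached : ∀ {x} → x ∈ S → (∀ {y} → y ∈ S → ¬ Attached x y) → Disconnected a b (v ∷ S)
    detached {x} x∈ free = δ , δ-invariant , x , v , there x∈ , here refl , δx≢δv
      where
      -- `v` is excluded by hand: it lies outside `S`, so `ℓ v` carries no information and might
      -- equal `ℓ x`.
      inside? : ∀ y → Dec (y ≢ v × ℓ y ≡ ℓ x)
      inside? y = ¬? (y ≟ v) ×-dec (ℓ y ℕ.≟ ℓ x)

      δ : V → ℕ
      δ y with inside? y
      ... | yes _ = 1
      ... | no _  = 0

      δ-cong : ∀ {y z} → (y ≢ v × ℓ y ≡ ℓ x → z ≢ v × ℓ z ≡ ℓ x) →
        (z ≢ v × ℓ z ≡ ℓ x → y ≢ v × ℓ y ≡ ℓ x) → δ y ≡ δ z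
      δ-cong {y} {z} to from with inside? y | inside? z
      ... | yes _ | yes _ = refl
      ... | yes p | no ¬q = ⊥-elim (¬q (to p))
      ... | no ¬p | yes q = ⊥-elim (¬p (from q))
      ... | no _  | no _  = refl

      ≢v : ∀ {y} → y ∈ S → y ≢ v
      ≢v y∈ refl = All.lookup (AllPairs.head v∷S!) y∈ refl

      δ-invariant : ∀ {y z} → y ∈ v ∷ S → z ∈ v ∷ S → Other a b y z → δ y ≡ δ z
      δ-invariant (here refl) (here refl) _ = refl
      δ-invariant (here refl) (there z∈) o =
        δ-cong (λ p → ⊥-elim (proj₁ p refl)) (λ p → ⊥-elim (free z∈ (proj₂ p , o)))
      δ-invariant (there y∈) (here refl) o =
        δ-cong (λ p → ⊥-elim (free y∈ (proj₂ p , other-sym o))) (λ p → ⊥-elim (proj₁ p refl))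
      δ-invariant (there y∈) (there z∈) o = δ-cong
        (λ p → ≢v z∈ , trans (sym (invariant y∈ z∈ o)) (proj₂ p))
        (λ p → ≢v y∈ , trans (invariant y∈ z∈ o) (proj₂ p))

      δx≢δv : δ x ≢ δ v
      δx≢δv with inside? x | inside? v
      ... | _     | yes p = ⊥-elim (proj₁ p refl)
      ... | no ¬p | no _  = ⊥-elim (¬p (≢v x∈ , refl))
      ... | yes _ | no _  = λ ()

    -- If v is attached to every component, all the edges attaching it have
    -- the same colour c, and v is isolated with respect to {a, c} or {b, c}.
    module AllAttached (att : ∀ {x} → x ∈ S → ∃[ y ] y ∈ S × Attached x y) where

      -- In the triangle `v`, `y`, `z` the edge `yz` has colour `a` or `b`, while the two edges at
      -- `v` have neither.
      same-colour : ∀ {y z} → y ∈ S → z ∈ S → ℓ y ≢ ℓ z → Other a b v y → Other a b v z →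
        χ v y ≡ χ v z
      same-colour {y} {z} y∈ z∈ y≁z oy oz with gallai v y z | two-coloured y∈ z∈ y≁z
      ... | inj₁ eq        | _ = eq
      ... | inj₂ (inj₁ eq) | inj₁ e = ⊥-elim (proj₁ oy (trans eq e))
      ... | inj₂ (inj₁ eq) | inj₂ e = ⊥-elim (proj₂ oy (trans eq e))
      ... | inj₂ (inj₂ eq) | inj₁ e = ⊥-elim (proj₁ oz (trans eq e))
      ... | inj₂ (inj₂ eq) | inj₂ e = ⊥-elim (proj₂ oz (trans eq e))

      -- Take attached vertices `p` and `q` in different components. An attached `z` outside the
      -- component of `p` is compared with `p` directly, one inside it by way of `q`.
      attaching-colour : ∃[ c ] ∀ {z} → z ∈ S → Other a b v z → χ v z ≡ c
      attaching-colour with separated disc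
      ... | x , y , x∈ , y∈ , x≁y with att x∈ | att y∈
      ...   | p , p∈ , p~x , op | q , q∈ , q~y , oq = χ v p , colour
        where
        p≁q : ℓ p ≢ ℓ q
        p≁q eq = x≁y (trans (sym p~x) (trans eq q~y))

        colour : ∀ {z} → z ∈ S → Other a b v z → χ v z ≡ χ v p
        colour {z} z∈ oz with ℓ z ℕ.≟ ℓ p
        ... | no z≁p  = same-colour z∈ p∈ z≁p oz op
        ... | yes z~p = trans (same-colour z∈ q∈ (p≁q ∘ trans (sym z~p)) oz oq)
          (sym (same-colour p∈ q∈ p≁q op oq))

      c : ℕ
      c = proj₁ attaching-colour

      -- The component of `x` contains some `w` attached to `v`. In the triangle `v`, `y`, `w` only
      -- `vw` has a colour other than `a` and `b`, so `yw` repeats the colour of `vy`; by uniformity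
      -- so does `yx`.
      forced : ∀ {d y} → χ v y ≡ d → y ∈ S → d ≡ a ⊎ d ≡ b →
        ∀ {x} → x ∈ S → ℓ y ≢ ℓ x → χ y x ≡ d
      forced {d} {y} refl y∈ d∈ {x} x∈ y≁x with att x∈
      ... | w , w∈ , w~x , ow = trans (sym (uniform y∈ w∈ x∈ w~x y≁w)) (yw d∈)
        where
        y≁w : ℓ y ≢ ℓ w
        y≁w eq = y≁x (trans eq w~x)

        yw : χ v y ≡ a ⊎ χ v y ≡ b → χ y w ≡ χ v y
        yw ab with gallai v y w | ab | two-coloured y∈ w∈ y≁w
        ... | inj₂ (inj₁ eq) | _ | _ = sym eq
        ... | inj₁ eq | inj₁ e | _ = ⊥-elim (proj₁ ow (trans (sym eq) e))
        ... | inj₁ eq | inj₂ e | _ = ⊥-elim (proj₂ ow (trans (sym eq) e))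
        ... | inj₂ (inj₂ eq) | _ | inj₁ e = ⊥-elim (proj₁ ow (trans eq e))
        ... | inj₂ (inj₂ eq) | _ | inj₂ e = ⊥-elim (proj₂ ow (trans eq e))

      -- By `forced`, `y` sends `a` and `z` sends `b` to all other components. If their components
      -- differ, the edge `yz` gets both colours; if not, a vertex outside sees `y` and `z` in one
      -- colour.
      not-both : ∀ {y z} → y ∈ S → z ∈ S → χ v y ≡ a → χ v z ≡ b → a ≢ b → ⊥
      not-both {y} {z} y∈ z∈ vy vz a≢b with ℓ y ℕ.≟ ℓ z
      ... | no y≁z  = a≢b (trans (sym (forced vy y∈ (inj₁ refl) z∈ y≁z))
        (trans (χ-sym y z) (forced vz z∈ (inj₂ refl) y∈ (≢-sym y≁z))))
      ... | yes y~z = elsewhere (outside (separated disc))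
        where
        outside : ∃[ p ] ∃[ q ] p ∈ S × q ∈ S × ℓ p ≢ ℓ q → ∃[ x ] x ∈ S × ℓ x ≢ ℓ y
        outside (p , q , p∈ , q∈ , p≁q) with ℓ p ℕ.≟ ℓ y
        ... | no p≁y  = p , p∈ , p≁y
        ... | yes p~y = q , q∈ , λ q~y → p≁q (trans p~y (sym q~y))

        elsewhere : ∃[ x ] x ∈ S × ℓ x ≢ ℓ y → ⊥
        elsewhere (x , x∈ , x≁y) = a≢b (trans (sym (forced vy y∈ (inj₁ refl) x∈ (≢-sym x≁y)))
          (trans (χ-sym y x) (trans (uniform x∈ y∈ z∈ y~z x≁y)
            (trans (χ-sym x z)
              (forced vz z∈ (inj₂ refl) x∈ (λ z~x → x≁y (sym (trans y~z z~x))))))))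

      w∈S : ∃[ w ] w ∈ S
      w∈S = let x , _ , x∈ , _ = separated disc in x , x∈

      disconnected : ∃[ a′ ] ∃[ b′ ] Disconnected a′ b′ (v ∷ S)
      -- Asking for a colour different from `b` in the first search provides `a ≢ b` when both
      -- searches succeed. If one fails, the edges at `v` use only `c` and one of `a`, `b`.
      disconnected with any? (λ y → ¬? (χ v y ℕ.≟ b) ×-dec (χ v y ℕ.≟ a)) S
                      | any? (λ y → ¬? (χ v y ℕ.≟ a) ×-dec (χ v y ℕ.≟ b)) S
      ... | no ¬A | _ = b , c , isolated⇒disconnected v∷S! (proj₂ w∈S) λ {y} y∈ (≢b , ≢c) →
        [ (λ e → ¬A (lose y∈ (≢b , e))) , ≢b ]′
          (¬other (≢c ∘ proj₂ attaching-colour y∈))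
      ... | yes _ | no ¬B = a , c , isolated⇒disconnected v∷S! (proj₂ w∈S) λ {y} y∈ (≢a , ≢c) →
        [ ≢a , (λ e → ¬B (lose y∈ (≢a , e))) ]′
          (¬other (≢c ∘ proj₂ attaching-colour y∈))
      ... | yes A | yes B with find A | find B
      ...   | y , y∈ , y≢b , vy | z , z∈ , _ , vz =
        ⊥-elim (not-both y∈ z∈ vy vz (λ a≡b → y≢b (trans vy a≡b)))

    extend : ∃[ a′ ] ∃[ b′ ] Disconnected a′ b′ (v ∷ S)
    extend with all? (λ x → any? (attached? x) S) S
    ... | yes att = AllAttached.disconnected λ x∈ → find (All.lookup att x∈)
    ... | no ¬att with find (All.¬All⇒Any¬ (λ x → any? (attached? x) S) S ¬att)
    ...   | x , x∈ , free = a , b , detached x∈ (λ y∈ at → free (lose y∈ at))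

  -- Gallai's theorem by induction on the vertices: each new vertex either keeps the pair of colours
  -- or trades one of them for the attaching colour. Two vertices are separated by the colour of
  -- their edge, taken twice.
  disconnecting-colours : ∀ {S} → Unique S → 2 ≤ length S → ∃[ a ] ∃[ b ] Disconnected a b S
  disconnecting-colours {v ∷ []} _ (s≤s ())
  disconnecting-colours {v ∷ w ∷ []} S! _ = χ v w , χ v w ,
    isolated⇒disconnected S! (here refl) λ { (here refl) (≢a , _) → ≢a refl }
  disconnecting-colours {v ∷ w ∷ u ∷ S} S!@(_ ∷ S!′) _ =
    Extend.extend S! (proj₂ (proj₂ (disconnecting-colours S!′ (s≤s (s≤s z≤n)))))

  gallai-partition : ∀ {S} → Unique S → 2 ≤ length S → Partition S
  gallai-partition {S} S! 2≤ with disconnecting-colours S! 2≤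
  ... | a , b , disc = record
    { ℓ           = ℓ
    ; palette     = λ { true → a ; false → b }
    ; bicoloured  = λ x∈ y∈ x≁y →
        [ (λ e → true , e) , (λ e → false , e) ]′ (two-coloured x∈ y∈ x≁y)
    ; homogeneous = λ x∈ y∈ z∈ → uniform x∈ y∈ z∈
    ; proper      = separated disc
    }
    where open Split a b S

-- Orderings and the bounds they impose.

module Ordering {V : Set} (χ : V → V → ℕ) where

  -- Each vertex stores its colour towards the later ones. Nothing follows the last vertex, so its
  -- colour is arbitrary; it is set to 0 wherever one has to be given.
  data Ordered : List V → Set where
    []  : Ordered []
    _∷_ : ∀ {x xs c} → All (λ y → x ≢ y × χ x y ≡ c) xs → Ordered xs → Ordered (x ∷ xs)

  Has : ℕ → List V → Set
  Has t S = ∃[ xs ] Ordered xs × length xs ≡ t × xs ⊆ S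

  cone : ∀ {t x c S W} → x ∈ S → W ⊆ S → (∀ {y} → y ∈ W → x ≢ y × χ x y ≡ c) →
    Has t W → Has (suc t) S
  cone {x = x} x∈ W⊆S eq (xs , o , refl , xs⊆W) = x ∷ xs , All.tabulate (eq ∘ xs⊆W) ∷ o , refl ,
    λ { (here refl) → x∈ ; (there y∈) → W⊆S (xs⊆W y∈) }

  Bound : ℕ → ℕ → Set
  Bound s N = ∀ {S} → Unique S → ¬ Has (suc s) S → length S ≤ N

  bound-0 : Bound 0 0
  bound-0 {[]}    _ _ = z≤n
  bound-0 {x ∷ S} _ none = ⊥-elim (none (x ∷ [] , _∷_ {c = 0} [] [] , refl ,
    λ { (here refl) → here refl }))

  bound-1 : Bound 1 1
  bound-1 {[]}        _ _ = z≤n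
  bound-1 {x ∷ []}    _ _ = s≤s z≤n
  bound-1 {x ∷ y ∷ S} ((x≢y ∷ _) ∷ _) none = ⊥-elim (none
    (x ∷ y ∷ [] , ((x≢y , refl) ∷ []) ∷ _∷_ {c = 0} [] [] , refl ,
      λ { (here refl) → here refl ; (there (here refl)) → there (here refl) }))

-- The upper bound.

module Upper {V : Set} (_≟_ : DecidableEquality V) (χ : V → V → ℕ)
  (χ-sym : ∀ x y → χ x y ≡ χ y x) (gallai : NoRainbowTriangle χ) where

  open Ordering χ
  open GallaiPartition _≟_ χ χ-sym gallai

  cherry : ∀ {x y z} → x ≢ y → x ≢ z → y ≢ z → χ x y ≡ χ x z →
    ∀ {S} → x ∈ S → y ∈ S → z ∈ S → Has 3 S
  cherry {x} {y} {z} x≢y x≢z y≢z eq x∈ y∈ z∈ = x ∷ y ∷ z ∷ [] ,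
    ((x≢y , eq) ∷ (x≢z , refl) ∷ []) ∷ ((y≢z , refl) ∷ []) ∷ _∷_ {c = 0} [] [] , refl ,
    λ { (here refl) → x∈ ; (there (here refl)) → y∈ ; (there (there (here refl))) → z∈ }

  -- Two sides of a triangle that is not rainbow agree; their common vertex goes first, and the
  -- order of the other two is free.
  bound-2 : Bound 2 2
  bound-2 {[]}         _ _ = z≤n
  bound-2 {_ ∷ []}     _ _ = s≤s z≤n
  bound-2 {_ ∷ _ ∷ []} _ _ = s≤s (s≤s z≤n)
  bound-2 {x ∷ y ∷ z ∷ S} ((x≢y ∷ x≢z ∷ _) ∷ (y≢z ∷ _) ∷ _) none with gallai x y z
  ... | inj₁ eq = ⊥-elim (none (cherry x≢y x≢z y≢z eq
          (here refl) (there (here refl)) (there (there (here refl)))))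
  ... | inj₂ (inj₁ eq) = ⊥-elim (none (cherry (≢-sym x≢y) y≢z x≢z (trans (χ-sym y x) eq)
          (there (here refl)) (here refl) (there (there (here refl)))))
  ... | inj₂ (inj₂ eq) = ⊥-elim (none (cherry (≢-sym x≢z) (≢-sym y≢z) x≢y
          (trans (χ-sym z x) (trans eq (χ-sym y z)))
          (there (there (here refl))) (here refl) (there (here refl))))

  -- Blocks, neighbourhoods and the odd case.

  module Blocks {S : List V} (S! : Unique S) (partition : Partition S) where
    open Partition partition

    _≁_ : V → V → Set
    x ≁ y = ℓ x ≢ ℓ y

    ≁⇒≢ : ∀ {x y} → x ≁ y → x ≢ y
    ≁⇒≢ x≁y = x≁y ∘ cong ℓ

    Coloured : ℕ → V → V → Set
    Coloured c x y = x ≁ y × χ x y ≡ c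

    coloured? : ∀ c x y → Dec (Coloured c x y)
    coloured? c x y = ¬? (ℓ x ℕ.≟ ℓ y) ×-dec (χ x y ℕ.≟ c)

    nbrs : ℕ → V → List V → List V
    nbrs c x = filter (coloured? c x)

    ∈nbrs⁻ : ∀ {c x y} U → y ∈ nbrs c x U → y ∈ U × Coloured c x y
    ∈nbrs⁻ {c} {x} U = ∈-filter⁻ (coloured? c x) {xs = U}

    block : V → List V → List V
    block x = filter (λ y → ℓ x ℕ.≟ ℓ y)

    _⊆[_]_ : List V → V → List V → Set
    B ⊆[ x ] U = ∀ {z} → z ∈ B → z ∈ U × ℓ x ≡ ℓ z

    block⊆ : ∀ x U → block x U ⊆[ x ] U
    block⊆ x U = ∈-filter⁻ (λ y → ℓ x ℕ.≟ ℓ y) {xs = U}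

    -- Only an inequality, because the two neighbourhoods coincide when the palette colours do. `β`
    -- chooses which of them is written first.
    length-block-nbrs : ∀ {U x} → U ⊆ S → x ∈ S → ∀ β → length U ≤
      length (block x U) + (length (nbrs (palette β) x U) + length (nbrs (palette (not β)) x U))
    length-block-nbrs {U} {x} U⊆S x∈ β = ≤-trans
      (length≤filter+filter (λ y → ℓ x ℕ.≟ ℓ y)
        (λ y → coloured? (palette β) x y ⊎-dec coloured? (palette (not β)) x y) U (cover β))
      (+-monoʳ-≤ (length (block x U))
        (length-filter-⊎ (coloured? (palette β) x) (coloured? (palette (not β)) x) U))
      where
      cover : ∀ β {y} → y ∈ U →
        ℓ x ≡ ℓ y ⊎ Coloured (palette β) x y ⊎ Coloured (palette (not β)) x y
      cover β {y} y∈ with ℓ x ℕ.≟ ℓ y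
      ... | yes x~y = inj₁ x~y
      ... | no x≁y with bicoloured x∈ (U⊆S y∈) x≁y | β
      ...   | true  , eq | true  = inj₂ (inj₁ (x≁y , eq))
      ...   | false , eq | true  = inj₂ (inj₂ (x≁y , eq))
      ...   | true  , eq | false = inj₂ (inj₂ (x≁y , eq))
      ...   | false , eq | false = inj₂ (inj₁ (x≁y , eq))

    -- By homogeneity a monochromatic neighbourhood consists of whole blocks, cut down to `U`.
    nbrs-closed : ∀ {c x y z U} → U ⊆ S → x ∈ S → y ∈ nbrs c x U → z ∈ U → ℓ y ≡ ℓ z →
      z ∈ nbrs c x U
    nbrs-closed {c} {x} {U = U} U⊆S x∈ y∈ z∈ y~z with ∈nbrs⁻ U y∈
    ... | y∈U , x≁y , eq = ∈-filter⁺ (coloured? c x) z∈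
      ((λ x~z → x≁y (trans x~z (sym y~z))) ,
       trans (sym (homogeneous x∈ (U⊆S y∈U) (U⊆S z∈) y~z x≁y)) eq)

    ¬Has-nbrs : ∀ {t c x} U → x ∈ U → ¬ Has (suc t) U → ¬ Has t (nbrs c x U)
    ¬Has-nbrs U x∈ none = none ∘ cone x∈ (proj₁ ∘ ∈nbrs⁻ U) λ y∈ →
      let _ , x≁y , eq = ∈nbrs⁻ U y∈ in ≁⇒≢ x≁y , eq

    cone-block : ∀ {t x y B U} → U ⊆ S → x ∈ U → y ∈ U → x ≁ y → B ⊆[ y ] U →
      Has t B → Has (suc t) U
    cone-block U⊆S x∈ y∈ x≁y B⊆ = cone x∈ (proj₁ ∘ B⊆) λ z∈ →
      let z∈U , y~z = B⊆ z∈ in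
      (λ x≡z → x≁y (trans (cong ℓ x≡z) (sym y~z))) ,
      sym (homogeneous (U⊆S x∈) (U⊆S y∈) (U⊆S z∈U) y~z x≁y)

    double-cone : ∀ {t x y z B U} → U ⊆ S → x ∈ U → y ∈ U → z ∈ U → x ≁ y → x ≁ z → y ≁ z →
      χ x y ≡ χ x z → B ⊆[ z ] U → Has t B → Has (2 + t) U
    double-cone {t} {x} {y} {z} {B} {U} U⊆S x∈ y∈ z∈ x≁y x≁z y≁z eq B⊆ has =
      cone x∈ sub spoke (cone-block sub⁺ (here refl) (there (here refl)) y≁z B⊆′ has)
      where
      W : List V
      -- `z` is kept as the vertex naming the block; after `x` the ordering uses only `y` and
      -- vertices of `B`.
      W = y ∷ z ∷ B

      sub : W ⊆ U
      sub (here refl)         = y∈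
      sub (there (here refl)) = z∈
      sub (there (there w∈))  = proj₁ (B⊆ w∈)

      sub⁺ : W ⊆ S
      sub⁺ = U⊆S ∘ sub

      B⊆′ : B ⊆[ z ] W
      B⊆′ w∈ = there (there w∈) , proj₂ (B⊆ w∈)

      spoke : ∀ {w} → w ∈ W → x ≢ w × χ x w ≡ χ x z
      spoke (here refl)         = ≁⇒≢ x≁y , eq
      spoke (there (here refl)) = ≁⇒≢ x≁z , refl
      spoke (there (there w∈))  = let w∈U , z~w = B⊆ w∈ in
        (λ x≡w → x≁z (trans (cong ℓ x≡w) (sym z~w))) ,
        sym (homogeneous (U⊆S x∈) (U⊆S z∈) (U⊆S w∈U) z~w x≁z)

    -- Either all edges leaving the block of x inside U have the same colour,
    -- which splits U into two parts of size at most N, or two of them with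
    -- different colours can be put in front of an ordering of the block.
    thin : ∀ {t N U B x y} → Bound (suc t) N → Unique U → U ⊆ S → ¬ Has (3 + t) U →
      N + N < length U → x ∈ U → y ∈ U → x ≁ y → B ⊆[ x ] U → ¬ Has (suc t) B
    thin {t} {N} {U} {B} {x} {y} bound U! U⊆S none large x∈ y∈ x≁y B⊆ has
      with all? (λ z → (ℓ x ℕ.≟ ℓ z) ⊎-dec (coloured? (χ x y) x z)) U
    ... | yes all = <⇒≱ large (≤-trans
      (length≤filter+filter (λ z → ℓ x ℕ.≟ ℓ z) (coloured? (χ x y) x) U (All.lookup all))
      (+-mono-≤
        (bound (Unique.filter⁺ _ U!)
          (none ∘ cone-block U⊆S y∈ x∈ (≢-sym x≁y) (block⊆ x U)))
        (bound (Unique.filter⁺ _ U!) (¬Has-nbrs U x∈ none))))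
    ... | no ¬all with find (All.¬All⇒Any¬ (λ z → (ℓ x ℕ.≟ ℓ z) ⊎-dec (coloured? (χ x y) x z)) U ¬all)
    ...   | z , z∈ , ¬z = contradict (gallai x y z)
      where
      x≁z : x ≁ z
      x≁z = ¬z ∘ inj₁

      xy≢xz : χ x y ≢ χ x z
      xy≢xz eq = ¬z (inj₂ (x≁z , sym eq))

      y≁z : y ≁ z
      y≁z y~z = xy≢xz (homogeneous (U⊆S x∈) (U⊆S y∈) (U⊆S z∈) y~z x≁y)

      contradict : χ x y ≡ χ x z ⊎ χ x y ≡ χ y z ⊎ χ x z ≡ χ y z → ⊥
      -- As `xy` and `xz` differ in colour, `yz` repeats one of them. The common end of the two
      -- equal edges, `y` or `z`, goes first, then the other of the two, then the block of `x`.
      contradict (inj₁ eq) = xy≢xz eq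
      contradict (inj₂ (inj₁ eq)) = none (double-cone U⊆S y∈ z∈ x∈ y≁z (≢-sym x≁y) (≢-sym x≁z)
        (trans (sym eq) (χ-sym x y)) B⊆ has)
      contradict (inj₂ (inj₂ eq)) = none (double-cone U⊆S z∈ y∈ x∈ (≢-sym y≁z) (≢-sym x≁z)
        (≢-sym x≁y) (trans (χ-sym z y) (trans (sym eq) (χ-sym x z))) B⊆ has)

    elsewhere : ∀ x → ∃[ y ] y ∈ S × x ≁ y
    elsewhere x with proper
    ... | p , q , p∈ , q∈ , p≁q with ℓ x ℕ.≟ ℓ p
    ...   | no x≁p  = p , p∈ , x≁p
    ...   | yes x~p = q , q∈ , λ x~q → p≁q (trans (sym x~p) x~q)

    odd-bound : ∀ {s q} → Bound (suc s) q → Bound (2 + s) (q + q) → ¬ Has (4 + s) S →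
      length S ≤ 5 * q
    odd-bound {s} {q} bound₁ bound₂ none = ≮⇒≥ λ large →
      let x , y , x∈ , y∈ , x≁y = proper
          -- The assumption `5 * q < length S`, which is to be refuted, lies above the threshold
          -- `(q + q) + (q + q)` of `thin`.
          4q<∣S∣ = ≤-<-trans (≤-trans (m≤n+m (q + q + (q + q)) q) (≤-reflexive (lemma q))) large
      in <⇒≱ large (begin
        length S  ≤⟨ length-block-nbrs id x∈ true ⟩
        length (block x S) + (length (nbrs (palette true) x S) + length (nbrs (palette false) x S))
          ≤⟨ +-mono-≤
              (bound₁ (Unique.filter⁺ _ S!) (thin bound₂ S! id none 4q<∣S∣ x∈ y∈ x≁y (block⊆ x S)))
              (+-mono-≤ (bound₂ (Unique.filter⁺ _ S!) (¬Has-nbrs S x∈ none))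
                        (bound₂ (Unique.filter⁺ _ S!) (¬Has-nbrs S x∈ none))) ⟩
        q + ((q + q) + (q + q))  ≡⟨ lemma q ⟩
        5 * q  ∎)
      where
      open ≤-Reasoning
      lemma : ∀ q → q + ((q + q) + (q + q)) ≡ 5 * q
      lemma = solve-∀

    ¬Has-block : ∀ {t N x B} → Bound (suc t) N → ¬ Has (3 + t) S → N + N < length S → x ∈ S →
      B ⊆[ x ] S → ¬ Has (suc t) B
    ¬Has-block {x = x} bound none large x∈ =
      let y , y∈ , x≁y = elsewhere x in thin bound S! id none large x∈ y∈ x≁y

    Representatives : List V → List V → Set
    Representatives R U = AllPairs _≁_ R × R ⊆ U × (∀ {x} → x ∈ U → ∃[ r ] r ∈ R × ℓ r ≡ ℓ x)

    representatives : ∀ U → ∃[ R ] Representatives R U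
    representatives [] = [] , [] , (λ ()) , λ ()
    representatives (x ∷ U) with representatives U
    ... | R , R! , R⊆U , covers = x ∷ R′ , All.tabulate (proj₂ ∘ ∈R′⁻) ∷ AllPairs.filter⁺ _ R! ,
      (λ { (here refl) → here refl ; (there r∈) → there (R⊆U (proj₁ (∈R′⁻ r∈))) }) , covers′
      where
      R′ : List V
      R′ = filter (λ r → ¬? (ℓ x ℕ.≟ ℓ r)) R

      ∈R′⁻ : ∀ {r} → r ∈ R′ → r ∈ R × x ≁ r
      ∈R′⁻ = ∈-filter⁻ (λ r → ¬? (ℓ x ℕ.≟ ℓ r)) {xs = R}

      covers′ : ∀ {y} → y ∈ x ∷ U → ∃[ r ] r ∈ x ∷ R′ × ℓ r ≡ ℓ y
      covers′ (here refl) = x , here refl , refl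
      covers′ (there y∈) with covers y∈
      ... | r , r∈ , r~y with ℓ x ℕ.≟ ℓ r
      ...   | yes x~r = x , here refl , trans x~r r~y
      ...   | no x≁r  = r , there (∈-filter⁺ _ r∈ x≁r) , r~y

    -- Stated for all lists in the block rather than for `block x S`, so that it also applies to the
    -- part of the block inside a neighbourhood.
    Small : V → ℕ → Set
    Small x N = ∀ {B} → Unique B → B ⊆[ x ] S → length B ≤ N

    length≤representatives : ∀ {q} R {U} → Unique U → U ⊆ S →
      (∀ {x} → x ∈ U → ∃[ r ] r ∈ R × ℓ r ≡ ℓ x) → (∀ {r} → r ∈ R → Small r q) →
      length U ≤ length R * q
    length≤representatives [] {[]} _ _ _ _ = z≤n
    length≤representatives [] {x ∷ U} _ _ covers _ with covers (here refl)
    ... | _ , () , _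
    length≤representatives {q} (r ∷ R) {U} U! U⊆S covers small = ≤-trans
      (length≤filter+filter (λ y → ℓ r ℕ.≟ ℓ y) (λ y → ¬? (ℓ r ℕ.≟ ℓ y)) U
        (λ {y} _ → toSum (ℓ r ℕ.≟ ℓ y)))
      (+-mono-≤
        (small (here refl) (Unique.filter⁺ _ U!) (λ z∈ →
          let z∈U , r~z = block⊆ r U z∈ in U⊆S z∈U , r~z))
        (length≤representatives R (Unique.filter⁺ _ U!) (U⊆S ∘ proj₁ ∘ ∈U′⁻) covers′
          (small ∘ there)))
      where
      ∈U′⁻ : ∀ {y} → y ∈ filter (λ y → ¬? (ℓ r ℕ.≟ ℓ y)) U → y ∈ U × r ≁ y
      ∈U′⁻ = ∈-filter⁻ (λ y → ¬? (ℓ r ℕ.≟ ℓ y)) {xs = U}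

      covers′ : ∀ {y} → y ∈ filter (λ y → ¬? (ℓ r ℕ.≟ ℓ y)) U → ∃[ r′ ] r′ ∈ R × ℓ r′ ≡ ℓ y
      covers′ y∈ with ∈U′⁻ y∈
      ... | y∈U , r≁y with covers y∈U
      ...   | _ , here refl , r~y = ⊥-elim (r≁y r~y)
      ...   | r′ , there r′∈ , r′~y = r′ , r′∈ , r′~y

    -- The even case.

    module Even {s q r} (r+r≤q : r + r ≤ q) (bound₀ : Bound s r) (bound₁ : Bound (1 + s) q)
      (bound₂ : Bound (2 + s) (q + q)) (bound₃ : Bound (3 + s) (5 * q))
      (none : ¬ Has (5 + s) S) (large : 10 * q < length S) where

      open ≤-Reasoning

      nbrsᵖ : Bool → V → List V → List V
      nbrsᵖ β = nbrs (palette β)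

      block≤2q : ∀ {x} → x ∈ S → Small x (q + q)
      -- With the bound `5 * q` the threshold of `thin` is exactly `10 * q`.
      block≤2q x∈ B! B⊆ = bound₂ B! (¬Has-block bound₃ none
        (≤-<-trans (≤-reflexive (lemma q)) large) x∈ B⊆)
        where
        lemma : ∀ q → 5 * q + 5 * q ≡ 10 * q
        lemma = solve-∀

      nbrs≤5q : ∀ {c x} → x ∈ S → length (nbrs c x S) ≤ 5 * q
      nbrs≤5q x∈ = bound₃ (Unique.filter⁺ _ S!) (¬Has-nbrs S x∈ none)

      -- Here `thin` is applied inside the neighbourhood, with threshold `4 * q`. It needs a second
      -- block there, which exists because a single block has at most `2 * q` vertices. The
      -- neighbourhood contains the whole block of `y`, so the result holds in `S`.
      blocks-in-large-nbrs : ∀ {c x y} → x ∈ S → 4 * q < length (nbrs c x S) → y ∈ nbrs c x S →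
        Small y q
      blocks-in-large-nbrs {c} {x} {y} x∈ 4q<∣U∣ y∈ B! B⊆
        with all? (λ z → ℓ y ℕ.≟ ℓ z) (nbrs c x S)
      ... | yes all = ⊥-elim (<⇒≱ 4q<∣U∣ (≤-trans
        (block≤2q (proj₁ (∈nbrs⁻ S y∈)) (Unique.filter⁺ _ S!)
          (λ z∈ → proj₁ (∈nbrs⁻ S z∈) , All.lookup all z∈))
        (≤-trans (m≤m+n (q + q) (q + q)) (≤-reflexive (lemma q)))))
        where
        lemma : ∀ q → q + q + (q + q) ≡ 4 * q
        lemma = solve-∀
      ... | no ¬all with find (All.¬All⇒Any¬ (λ z → ℓ y ℕ.≟ ℓ z) (nbrs c x S) ¬all)
      ...   | z , z∈ , y≁z = bound₁ B! (thin bound₂ (Unique.filter⁺ _ S!) (proj₁ ∘ ∈nbrs⁻ S)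
        (¬Has-nbrs S x∈ none) (≤-<-trans (≤-reflexive (lemma q)) 4q<∣U∣) y∈ z∈ y≁z
        (λ w∈ → let w∈S , y~w = B⊆ w∈ in nbrs-closed id x∈ y∈ w∈S y~w , y~w))
        where
        lemma : ∀ q → q + q + (q + q) ≡ 4 * q
        lemma = solve-∀

      -- Of more than `10 * q` vertices the block takes at most `q` and the other neighbourhood at
      -- most `5 * q`.
      large-nbrs : ∀ {x} → x ∈ S → Small x q → ∀ β → 4 * q < length (nbrsᵖ β x S)
      large-nbrs {x} x∈ small β = +-cancelʳ-< (6 * q) (4 * q) _ (begin-strict
        4 * q + 6 * q  ≡⟨ lemma₁ q ⟩
        10 * q         <⟨ large ⟩
        length S       ≤⟨ length-block-nbrs id x∈ β ⟩
        length (block x S) + (length (nbrsᵖ β x S) + length (nbrsᵖ (not β) x S))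
          ≤⟨ +-mono-≤ (small (Unique.filter⁺ _ S!) (block⊆ x S))
               (+-monoʳ-≤ (length (nbrsᵖ β x S)) (nbrs≤5q x∈)) ⟩
        q + (length (nbrsᵖ β x S) + 5 * q)  ≡⟨ lemma₂ q (length (nbrsᵖ β x S)) ⟩
        length (nbrsᵖ β x S) + 6 * q        ∎)
        where
        lemma₁ : ∀ q → 4 * q + 6 * q ≡ 10 * q
        lemma₁ = solve-∀
        lemma₂ : ∀ q n → q + (n + 5 * q) ≡ n + 6 * q
        lemma₂ = solve-∀

      -- Otherwise the block and its two neighbourhoods would have at most `2 * q + 4 * q + 4 * q`
      -- vertices.
      some-large-nbrs : ∀ {x} → x ∈ S → ∃[ β ] 4 * q < length (nbrsᵖ β x S)
      some-large-nbrs {x} x∈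
        with 4 * q <? length (nbrsᵖ true x S) | 4 * q <? length (nbrsᵖ false x S)
      ... | yes p | _     = true , p
      ... | no _  | yes p = false , p
      ... | no p  | no p′ = ⊥-elim (<⇒≱ large (begin
        length S  ≤⟨ length-block-nbrs id x∈ true ⟩
        length (block x S) + (length (nbrsᵖ true x S) + length (nbrsᵖ false x S))
          ≤⟨ +-mono-≤ (block≤2q x∈ (Unique.filter⁺ _ S!) (block⊆ x S))
               (+-mono-≤ (≮⇒≥ p) (≮⇒≥ p′)) ⟩
        q + q + (4 * q + 4 * q)  ≡⟨ lemma q ⟩
        10 * q  ∎))
        where
        lemma : ∀ q → q + q + (4 * q + 4 * q) ≡ 10 * q
        lemma = solve-∀

      some-small : ∃[ x ] x ∈ S × Small x q
      some-small =
        let x , _ , x∈ , _ = proper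
            β , 4q<∣U∣     = some-large-nbrs x∈
            y , y∈         = 0<length⇒∃∈ (≤-<-trans z≤n 4q<∣U∣)
        in y , proj₁ (∈nbrs⁻ S y∈) , blocks-in-large-nbrs x∈ 4q<∣U∣ y∈

      -- Both neighbourhoods of a small block are large, and every other block lies in one of them.
      all-small : ∀ {x} → x ∈ S → Small x q
      all-small {x} x∈ with some-small
      ... | y , y∈ , small with ℓ y ℕ.≟ ℓ x
      ...   | yes y~x = λ B! B⊆ → small B! λ z∈ → let z∈S , x~z = B⊆ z∈ in z∈S , trans y~x x~z
      ...   | no y≁x with bicoloured y∈ x∈ y≁x
      ...     | β , eq = blocks-in-large-nbrs y∈ (large-nbrs y∈ small β)
        (∈-filter⁺ (coloured? (palette β) y) x∈ (y≁x , eq))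

      -- The neighbourhood of `x` in the colour of `xy` contains `y`; inside it, two cones leave at
      -- most `2 * q` vertices for each neighbourhood of `y`. The total is at most
      -- `r + (r + 4 * q) + 5 * q`, which `r + r ≤ q` brings down to `10 * q`.
      not-both-tiny : ∀ {x y} → x ∈ S → y ∈ S → x ≁ y → Small x r → ¬ Small y r
      not-both-tiny {x} {y} x∈ y∈ x≁y tiny-x tiny-y with bicoloured x∈ y∈ x≁y
      ... | β , eq = <⇒≱ large (begin
        length S  ≤⟨ length-block-nbrs id x∈ β ⟩
        length (block x S) + (length U + length (nbrsᵖ (not β) x S))
          ≤⟨ +-mono-≤ (tiny-x (Unique.filter⁺ _ S!) (block⊆ x S))
               (+-mono-≤ ∣U∣≤r+4q (nbrs≤5q x∈)) ⟩
        r + (r + (q + q + (q + q)) + 5 * q)  ≡⟨ lemma₁ r q ⟩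
        r + r + 9 * q                        ≤⟨ +-monoˡ-≤ (9 * q) r+r≤q ⟩
        q + 9 * q                            ≡⟨ lemma₂ q ⟩
        10 * q                               ∎)
        where
        U : List V
        U = nbrsᵖ β x S

        y∈U : y ∈ U
        y∈U = ∈-filter⁺ (coloured? (palette β) x) y∈ (x≁y , eq)

        nbrs≤2q : ∀ {c} → length (nbrs c y U) ≤ q + q
        nbrs≤2q = bound₂ (Unique.filter⁺ _ (Unique.filter⁺ _ S!))
          (¬Has-nbrs U y∈U (¬Has-nbrs S x∈ none))

        ∣U∣≤r+4q : length U ≤ r + (q + q + (q + q))
        ∣U∣≤r+4q = ≤-trans (length-block-nbrs (proj₁ ∘ ∈nbrs⁻ S) y∈ true)
          (+-mono-≤ (tiny-y (Unique.filter⁺ _ (Unique.filter⁺ _ S!)) λ z∈ →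
              let z∈U , y~z = block⊆ y U z∈ in proj₁ (∈nbrs⁻ S z∈U) , y~z)
            (+-mono-≤ nbrs≤2q nbrs≤2q))

        lemma₁ : ∀ r q → r + (r + (q + q + (q + q)) + 5 * q) ≡ r + r + 9 * q
        lemma₁ = solve-∀
        lemma₂ : ∀ q → q + 9 * q ≡ 10 * q
        lemma₂ = solve-∀

      module _ {c d : ℕ} {x y : V} (x∈ : x ∈ S) (y∈U : y ∈ nbrs c x S) where

        private
          U W : List V
          U = nbrs c x S
          W = nbrs d y U

          y∈ : y ∈ S
          y∈ = proj₁ (∈nbrs⁻ S y∈U)

          U⊆S : U ⊆ S
          U⊆S = proj₁ ∘ ∈nbrs⁻ S

          W⊆S : W ⊆ S
          W⊆S = U⊆S ∘ proj₁ ∘ ∈nbrs⁻ U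

        -- `l`, then `m`, then an ordering of the block of `p` is an ordering in `W`. Since `x` and
        -- `y` can be put in front of it, that block admits only orderings of length `s`.
        tiny : ∀ {l m p} → l ∈ W → m ∈ W → p ∈ W → l ≁ m → l ≁ p → m ≁ p → χ l m ≡ χ l p →
          Small p r
        tiny l∈ m∈ p∈ l≁m l≁p m≁p eq B! B⊆ = bound₀ B! λ has →
          ¬Has-nbrs U y∈U (¬Has-nbrs S x∈ none)
            (double-cone W⊆S l∈ m∈ p∈ l≁m l≁p m≁p eq
              (λ z∈ → let z∈S , p~z = B⊆ z∈ in
                nbrs-closed U⊆S y∈ p∈ (nbrs-closed id x∈ (proj₁ (∈nbrs⁻ U p∈)) z∈S p~z) p~z , p~z)
              has)

        -- The two ends of a cherry are interchangeable, so both their blocks would be tiny.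
        no-cherry : ∀ {l m p} → l ∈ W → m ∈ W → p ∈ W → l ≁ m → l ≁ p → m ≁ p → χ l m ≢ χ l p
        no-cherry l∈ m∈ p∈ l≁m l≁p m≁p eq = not-both-tiny (W⊆S m∈) (W⊆S p∈) m≁p
          (tiny l∈ p∈ m∈ l≁p l≁m (≢-sym m≁p) (sym eq)) (tiny l∈ m∈ p∈ l≁m l≁p m≁p eq)

        at-most-two : ∀ {L} → AllPairs _≁_ L → L ⊆ W → length L ≤ 2
        at-most-two {[]}         _ _ = z≤n
        at-most-two {_ ∷ []}     _ _ = s≤s z≤n
        at-most-two {_ ∷ _ ∷ []} _ _ = s≤s (s≤s z≤n)
        at-most-two {l ∷ m ∷ p ∷ _} ((l≁m ∷ l≁p ∷ _) ∷ (m≁p ∷ _) ∷ _) L⊆W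
          with L⊆W (here refl) | L⊆W (there (here refl)) | L⊆W (there (there (here refl)))
        ... | l∈ | m∈ | p∈ with gallai l m p
        ...   | inj₁ eq = ⊥-elim (no-cherry l∈ m∈ p∈ l≁m l≁p m≁p eq)
        ...   | inj₂ (inj₁ eq) = ⊥-elim (no-cherry m∈ l∈ p∈ (≢-sym l≁m) m≁p l≁p
          (trans (χ-sym m l) eq))
        ...   | inj₂ (inj₂ eq) = ⊥-elim (no-cherry p∈ l∈ m∈ (≢-sym l≁p) (≢-sym m≁p) l≁m
          (trans (χ-sym p l) (trans eq (χ-sym m p))))

      -- One representative `y`, and by `at-most-two` at most two more in each of the two colours
      -- seen from `y`.
      at-most-five : ∀ {c x L} → x ∈ S → AllPairs _≁_ L → L ⊆ nbrs c x S → length L ≤ 5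
      at-most-five {L = []} _ _ _ = z≤n
      at-most-five {c} {x} {y ∷ L} x∈ (y≁L ∷ L!) L⊆U = s≤s (begin
        length L  ≤⟨ length≤filter+filter (coloured? (palette true) y)
                       (coloured? (palette false) y) L bi ⟩
        length (nbrsᵖ true y L) + length (nbrsᵖ false y L)
                  ≤⟨ +-mono-≤ (two true) (two false) ⟩
        4         ∎)
        where
        y∈U : y ∈ nbrs c x S
        y∈U = L⊆U (here refl)

        bi : ∀ {z} → z ∈ L → Coloured (palette true) y z ⊎ Coloured (palette false) y z
        bi z∈ with All.lookup y≁L z∈
        ... | y≁z with bicoloured (proj₁ (∈nbrs⁻ S y∈U)) (proj₁ (∈nbrs⁻ S (L⊆U (there z∈)))) y≁z
        ...   | true  , eq = inj₁ (y≁z , eq)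
        ...   | false , eq = inj₂ (y≁z , eq)

        two : ∀ β → length (nbrsᵖ β y L) ≤ 2
        two β = at-most-two x∈ y∈U (AllPairs.filter⁺ _ L!) λ z∈ →
          let z∈L , col = ∈nbrs⁻ L z∈ in
          ∈-filter⁺ (coloured? (palette β) y) (L⊆U (there z∈L)) col

      R : List V
      R = proj₁ (representatives S)

      R! : AllPairs _≁_ R
      R! = proj₁ (proj₂ (representatives S))

      R⊆S : R ⊆ S
      R⊆S = proj₁ (proj₂ (proj₂ (representatives S)))

      R-covers : ∀ {x} → x ∈ S → ∃[ y ] y ∈ R × ℓ y ≡ ℓ x
      R-covers = proj₂ (proj₂ (proj₂ (representatives S)))

      degree≡5 : ∀ β {x} → x ∈ R → length (nbrsᵖ β x R) ≡ 5
      degree≡5 β {x} x∈ = ≤-antisym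
        (at-most-five (R⊆S x∈) (AllPairs.filter⁺ _ R!) λ z∈ →
          let z∈R , col = ∈nbrs⁻ R z∈ in ∈-filter⁺ (coloured? (palette β) x) (R⊆S z∈R) col)
        -- More than `4 * q` vertices in blocks of size at most `q` require at least five blocks.
        (*-cancelʳ-< q 4 _ (<-≤-trans (large-nbrs (R⊆S x∈) (all-small (R⊆S x∈)) β)
          (length≤representatives (nbrsᵖ β x R) (Unique.filter⁺ _ S!) (proj₁ ∘ ∈nbrs⁻ S) covers
            (all-small ∘ R⊆S ∘ proj₁ ∘ ∈nbrs⁻ R))))
        where
        covers : ∀ {y} → y ∈ nbrsᵖ β x S → ∃[ z ] z ∈ nbrsᵖ β x R × ℓ z ≡ ℓ y
        covers y∈ with ∈nbrs⁻ S y∈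
        ... | y∈S , _ with R-covers y∈S
        ...   | z , z∈ , z~y = z , ∈-filter⁺ (coloured? (palette β) x) z∈
          (proj₂ (∈nbrs⁻ S (nbrs-closed id (R⊆S x∈) y∈ (R⊆S z∈) (sym z~y)))) , z~y

      ∣R∣≡11 : length R ≡ 11
      -- Ten blocks hold at most `10 * q` vertices; conversely there are one block and five
      -- neighbours in each colour.
      ∣R∣≡11 = ≤-antisym upper (*-cancelʳ-< q 10 _ (<-≤-trans large
        (length≤representatives R S! id R-covers (all-small ∘ R⊆S))))
        where
        single : ∀ x {L} → AllPairs _≁_ L → (∀ {y} → y ∈ L → ℓ x ≡ ℓ y) → length L ≤ 1
        single x {[]}        _ _ = z≤n
        single x {_ ∷ []}    _ _ = s≤s z≤n
        single x {_ ∷ _ ∷ _} ((≁ ∷ _) ∷ _) same =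
          ⊥-elim (≁ (trans (sym (same (here refl))) (same (there (here refl)))))

        upper : length R ≤ 11
        upper with some-small
        ... | x₀ , x₀∈ , _ with R-covers x₀∈
        ...   | x , x∈ , _ = ≤-trans (length-block-nbrs R⊆S (R⊆S x∈) true)
          (+-mono-≤ (single x (AllPairs.filter⁺ _ R!) (proj₂ ∘ block⊆ x R))
            (+-mono-≤ (≤-reflexive (degree≡5 true x∈)) (≤-reflexive (degree≡5 false x∈))))

      absurd : ⊥
      -- The degrees in the colour `palette true` sum to 11 * 5 = 55, an odd number.
      absurd = let e , eq = handshake R in
        odd e (trans (sym (trans (degrees-regular R R (degree≡5 true))
          (cong (_* 5) {length R} {11} ∣R∣≡11))) eq)
        where
        open Symmetric (coloured? (palette true))
          (λ {x} {y} (x≁y , eq) → ≢-sym x≁y , trans (χ-sym y x) eq) (λ (x≁x , _) → x≁x refl)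

        odd : ∀ e → 55 ≢ e + e
        odd e eq with e ≤? 27
        ... | yes e≤27 = <⇒≱ (n<1+n 54) (≤-trans (≤-reflexive eq) (+-mono-≤ e≤27 e≤27))
        ... | no e≰27  = <⇒≱ (n<1+n 55)
          (≤-trans (+-mono-≤ (≰⇒> e≰27) (≰⇒> e≰27)) (≤-reflexive (sym eq)))

  -- Induction on the length of the ordering.

  odd-step : ∀ {s q} → 1 ≤ q → Bound (1 + s) q → Bound (2 + s) (q + q) → Bound (3 + s) (5 * q)
  odd-step {q = q} 1≤q bound₁ bound₂ {S} S! none with length S ≤? 1
  -- A Gallai partition needs two vertices; shorter lists are covered by `1 ≤ q`.
  ... | yes ≤1 = ≤-trans ≤1 (≤-trans 1≤q (m≤n*m q 5))
  ... | no ≰1  = Blocks.odd-bound S! (gallai-partition S! (≰⇒> ≰1)) bound₁ bound₂ none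

  even-step : ∀ {s q r} → 1 ≤ q → r + r ≤ q → Bound s r → Bound (1 + s) q →
    Bound (2 + s) (q + q) → Bound (3 + s) (5 * q) → Bound (4 + s) (10 * q)
  even-step {q = q} 1≤q r+r≤q bound₀ bound₁ bound₂ bound₃ {S} S! none = ≮⇒≥ λ large →
    let 2≤∣S∣ = ≤-trans (s≤s 1≤q) (≤-<-trans (m≤n*m q 10) large) in
    Blocks.Even.absurd S! (gallai-partition S! 2≤∣S∣) r+r≤q bound₀ bound₁ bound₂ bound₃ none large

  -- `r` is 0 for `t = 0` and twice the previous power of 5 afterwards, so that `r + r` stays below
  -- `5 ^ t` as `even-step` demands.
  record Bounds (t : ℕ) : Set where
    field
      r       : ℕ
      r+r≤5^t : r + r ≤ 5 ^ t
      bound₀  : Bound (t * 2) r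
      bound₁  : Bound (1 + (t * 2)) (5 ^ t)
      bound₂  : Bound (2 + (t * 2)) (5 ^ t + 5 ^ t)

  bounds : ∀ t → Bounds t
  bounds zero = record
    { r = 0 ; r+r≤5^t = z≤n ; bound₀ = bound-0 ; bound₁ = bound-1 ; bound₂ = bound-2 }
  bounds (suc t) = record
    { r       = 5 ^ t + 5 ^ t
    ; r+r≤5^t = ≤-trans (m≤n+m _ (5 ^ t)) (≤-reflexive (lemma₁ (5 ^ t)))
    ; bound₀  = IH.bound₂
    ; bound₁  = next₁
    ; bound₂  = λ {S} → subst (λ N → Bound (4 + (t * 2)) N) (lemma₂ (5 ^ t))
        (even-step {r = IH.r} 1≤5^t IH.r+r≤5^t IH.bound₀ IH.bound₁ IH.bound₂ next₁) {S}
    }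
    where
    module IH = Bounds (bounds t)

    1≤5^t : 1 ≤ 5 ^ t
    1≤5^t = m^n>0 5 t

    next₁ : Bound (3 + (t * 2)) (5 ^ suc t)
    next₁ = odd-step 1≤5^t IH.bound₁ IH.bound₂

    lemma₁ : ∀ q → q + (q + q + (q + q)) ≡ 5 * q
    lemma₁ = solve-∀
    lemma₂ : ∀ q → 10 * q ≡ 5 * q + 5 * q
    lemma₂ = solve-∀

-- Passing between edge colourings and colour functions.

∃Vec? : ∀ {n} t {P : Vec (Fin n) t → Set} → Decidable P → Dec (∃ P)
∃Vec? zero    P? = map′ ([] ,_) (λ { ([] , p) → p }) (P? [])
∃Vec? (suc t) P? = map′ (λ (x , xs , p) → x ∷ xs , p) (λ { (x ∷ xs , p) → x , xs , p })
  (Fin.any? λ x → ∃Vec? t λ xs → P? (x ∷ xs))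

list⇒vec : ∀ {A : Set} {t} (xs : List A) → length xs ≡ t → Σ[ v ∈ Vec A t ] toList v ≡ xs
list⇒vec xs refl = fromList xs , toList∘fromList xs

module _ {n : ℕ} (χ : Fin n → Fin n → ℕ) where
  open Ordering χ

  ordered? : Decidable Ordered
  ordered? [] = yes []
  ordered? (x ∷ []) = yes (_∷_ {c = 0} [] [])
  ordered? (x ∷ y ∷ ys)
    -- Once a next vertex `y` exists, the stored colour of `x` can only be `χ x y`, so a single
    -- candidate has to be tested.
    with all? (λ z → ¬? (x Fin.≟ z) ×-dec (χ x z ℕ.≟ χ x y)) (y ∷ ys) | ordered? (y ∷ ys)
  ... | yes p | yes o = yes (p ∷ o)
  ... | _     | no ¬o = no λ { (_ ∷ o) → ¬o o }
  ... | no ¬p | yes _ = no λ { (((x≢y , refl) ∷ p) ∷ _) → ¬p ((x≢y , refl) ∷ p) }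

  ordered-lookup : ∀ {s} {xs : Vec (Fin n) s} → Ordered (toList xs) →
    Σ[ c ∈ (Fin s → ℕ) ] ∀ {i j} → i Fin.< j →
      lookup xs i ≢ lookup xs j × χ (lookup xs i) (lookup xs j) ≡ c i
  ordered-lookup {xs = []} [] = (λ ()) , λ { {()} }
  ordered-lookup {suc s} {x ∷ xs} (_∷_ {c = c₀} all o) with ordered-lookup {xs = xs} o
  ... | c , spoke = c′ , spoke′
    where
    c′ : Fin (suc s) → ℕ
    c′ zero    = c₀
    c′ (suc i) = c i

    spoke′ : ∀ {i j} → i Fin.< j →
      lookup (x ∷ xs) i ≢ lookup (x ∷ xs) j × χ (lookup (x ∷ xs) i) (lookup (x ∷ xs) j) ≡ c′ i
    spoke′ {zero}  {suc j} _ = All.lookup all (∈-toList⁺ (∈-lookup j xs))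
    spoke′ {suc i} {suc j} (s≤s i<j) = spoke i<j

module _ {V : Set} {χ : V → V → ℕ} where
  open Ordering χ

  tabulate-ordered : ∀ {s} (f : Fin s → V) → (∀ {i j} → i Fin.< j → f i ≢ f j) →
    (∀ {i j k} → i Fin.< j → i Fin.< k → χ (f i) (f j) ≡ χ (f i) (f k)) → Ordered (tabulate f)
  tabulate-ordered {zero} f _ _ = []
  tabulate-ordered {suc zero} f _ _ = _∷_ {c = 0} [] []
  tabulate-ordered {suc (suc s)} f distinct mono =
    All.tabulate⁺ (λ i → distinct {zero} {suc i} (s≤s z≤n) ,
      mono {zero} {suc i} {suc zero} (s≤s z≤n) (s≤s z≤n)) ∷
    tabulate-ordered (f ∘ suc) (λ {i} {j} i<j → distinct {suc i} {suc j} (s≤s i<j))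
      (λ {i} {j} {k} i<j i<k → mono {suc i} {suc j} {suc k} (s≤s i<j) (s≤s i<k))

sameEdge-join : ∀ {n} {a b c d x y : Fin n} → SameEdge a b x y → SameEdge c d x y →
  SameEdge a b c d
sameEdge-join (inj₁ (refl , refl)) (inj₁ (refl , refl)) = inj₁ (refl , refl)
sameEdge-join (inj₁ (refl , refl)) (inj₂ (refl , refl)) = inj₂ (refl , refl)
sameEdge-join (inj₂ (refl , refl)) (inj₁ (refl , refl)) = inj₂ (refl , refl)
sameEdge-join (inj₂ (refl , refl)) (inj₂ (refl , refl)) = inj₁ (refl , refl)

-- The end points of the edges of a triangle, indexed by their opposite vertices.
end₁ end₂ : Fin 3 → Fin 3
end₁ zero             = suc zero
end₁ (suc zero)       = zero
end₁ (suc (suc zero)) = zero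
end₂ zero             = suc (suc zero)
end₂ (suc zero)       = suc (suc zero)
end₂ (suc (suc zero)) = suc zero

triangle-edge : ∀ {a b : Fin 3} → a ≢ b → ∃[ i ] SameEdge a b (end₁ i) (end₂ i)
triangle-edge {zero}           {zero}           a≢b = ⊥-elim (a≢b refl)
triangle-edge {zero}           {suc zero}       _   = suc (suc zero) , inj₁ (refl , refl)
triangle-edge {zero}           {suc (suc zero)} _   = suc zero , inj₁ (refl , refl)
triangle-edge {suc zero}       {zero}           _   = suc (suc zero) , inj₂ (refl , refl)
triangle-edge {suc zero}       {suc zero}       a≢b = ⊥-elim (a≢b refl)
triangle-edge {suc zero}       {suc (suc zero)} _   = zero , inj₁ (refl , refl)
triangle-edge {suc (suc zero)} {zero}           _   = suc zero , inj₂ (refl , refl)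
triangle-edge {suc (suc zero)} {suc zero}       _   = zero , inj₂ (refl , refl)
triangle-edge {suc (suc zero)} {suc (suc zero)} a≢b = ⊥-elim (a≢b refl)

module Colouring {n k : ℕ} (colouring : EdgeColoring (complete n) (Fin k)) where
  open EdgeColoring colouring

  -- The value 0 on the diagonal is junk.
  χ : Fin n → Fin n → ℕ
  χ u v with u Fin.≟ v
  ... | yes _  = 0
  ... | no u≢v = toℕ (color u≢v)

  color-irrelevant : ∀ {u v} (e e′ : u ≢ v) → color e ≡ color e′
  color-irrelevant e e′ = trans (undirected e (≢-sym e)) (undirected (≢-sym e) e′)

  χ-color : ∀ {u v} (e : u ≢ v) → toℕ (color e) ≡ χ u v
  χ-color {u} {v} e with u Fin.≟ v
  ... | yes u≡v = ⊥-elim (e u≡v)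
  ... | no u≢v  = cong toℕ (color-irrelevant e u≢v)

  χ-sym : ∀ u v → χ u v ≡ χ v u
  χ-sym u v with u Fin.≟ v | v Fin.≟ u
  ... | yes _ | yes _ = refl
  ... | yes p | no ¬q = ⊥-elim (¬q (sym p))
  ... | no ¬p | yes q = ⊥-elim (¬p (sym q))
  ... | no p  | no q  = cong toℕ (undirected p q)

  open Ordering χ

  orderable-copy : ∀ {s} (xs : Vec (Fin n) (suc s)) → Ordered (toList xs) →
    ∃[ K ] Orderable (inherited {H = complete (suc s)} colouring K)
  orderable-copy {s} xs o with ordered-lookup χ {xs = xs} o
  ... | c , spoke = K , Permutation.id , Vec.tabulate label , λ {i} {j} i<j e →
    Fin.toℕ-injective (trans (χ-color (preserves e)) (trans (proj₂ (spoke i<j))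
      (sym (trans (cong toℕ (lookup∘tabulate label (position i<j))) (label-correct i<j)))))
    where
    distinct : ∀ {i j} → lookup xs i ≡ lookup xs j → i ≡ j
    distinct {i} {j} eq with Fin.<-cmp i j
    ... | tri< i<j _ _ = ⊥-elim (proj₁ (spoke i<j) eq)
    ... | tri≈ _ i≡j _ = i≡j
    ... | tri> _ _ j<i = ⊥-elim (proj₁ (spoke j<i) (sym eq))

    K : Copy (complete (suc s)) (complete n)
    K = record { embed = mk↣ distinct ; preserves = λ u≢v → u≢v ∘ distinct }
    open Copy K

    i<1+i : ∀ (i : Fin s) → inject₁ i Fin.< suc i
    i<1+i i = s≤s (≤-reflexive (Fin.toℕ-inject₁ i))

    -- `c` only provides natural numbers, so the colour in `Fin k` is read off the edge from
    -- position `i` to the next one.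
    label : Fin s → Fin k
    label i = color (proj₁ (spoke (i<1+i i)))

    label-correct : ∀ {i j : Fin (suc s)} (i<j : i Fin.< j) → toℕ (label (position i<j)) ≡ c i
    label-correct {i} i<j = trans (χ-color _) (trans (proj₂ (spoke (i<1+i (position i<j))))
      (cong c (Fin.toℕ-injective (trans (Fin.toℕ-inject₁ (position i<j)) (Fin.toℕ-fromℕ< _)))))

  RainbowTriangle : Fin n → Fin n → Fin n → Set
  RainbowTriangle u v w = χ u v ≢ χ u w × χ u v ≢ χ v w × χ u w ≢ χ v w

  rainbow-copy : ∀ {u v w} → RainbowTriangle u v w →
    ∃[ K ] Rainbow (inherited {H = complete 3} colouring K)
  rainbow-copy {u} {v} {w} (uv≢uw , uv≢vw , uw≢vw) = K , λ e e′ different eq →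
    let i , a = triangle-edge e
        j , b = triangle-edge e′
    in different (sameEdge-join a (subst (λ l → SameEdge _ _ (end₁ l) (end₂ l)) (sym
      (sides-distinct (trans (sym (side a)) (trans (sym (χ-color (preserves e)))
        (trans (cong toℕ eq) (trans (χ-color (preserves e′)) (side b))))))) b))
    where
    f : Fin 3 → Fin n
    f zero             = u
    f (suc zero)       = v
    f (suc (suc zero)) = w

    -- A repeated vertex would make two of the three colours equal. So degenerate triples are never
    -- rainbow, and `NoRainbowTriangle` can range over all triples.
    u≢v : u ≢ v
    u≢v refl = uw≢vw refl
    u≢w : u ≢ w
    u≢w refl = uv≢vw (χ-sym u v)
    v≢w : v ≢ w
    v≢w refl = uv≢uw refl

    f-injective : ∀ {a b} → f a ≡ f b → a ≡ b
    f-injective {zero}           {zero}           _  = refl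
    f-injective {zero}           {suc zero}       eq = ⊥-elim (u≢v eq)
    f-injective {zero}           {suc (suc zero)} eq = ⊥-elim (u≢w eq)
    f-injective {suc zero}       {zero}           eq = ⊥-elim (u≢v (sym eq))
    f-injective {suc zero}       {suc zero}       _  = refl
    f-injective {suc zero}       {suc (suc zero)} eq = ⊥-elim (v≢w eq)
    f-injective {suc (suc zero)} {zero}           eq = ⊥-elim (u≢w (sym eq))
    f-injective {suc (suc zero)} {suc zero}       eq = ⊥-elim (v≢w (sym eq))
    f-injective {suc (suc zero)} {suc (suc zero)} _  = refl

    K : Copy (complete 3) (complete n)
    K = record { embed = mk↣ f-injective ; preserves = λ a≢b → a≢b ∘ f-injective }
    open Copy K

    side : ∀ {a b i} → SameEdge a b (end₁ i) (end₂ i) →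
      χ (f a) (f b) ≡ χ (f (end₁ i)) (f (end₂ i))
    side (inj₁ (refl , refl)) = refl
    side {i = i} (inj₂ (refl , refl)) = χ-sym (f (end₂ i)) (f (end₁ i))

    sides-distinct : ∀ {i j} →
      χ (f (end₁ i)) (f (end₂ i)) ≡ χ (f (end₁ j)) (f (end₂ j)) → i ≡ j
    sides-distinct {zero}           {zero}           _  = refl
    sides-distinct {zero}           {suc zero}       eq = ⊥-elim (uw≢vw (sym eq))
    sides-distinct {zero}           {suc (suc zero)} eq = ⊥-elim (uv≢vw (sym eq))
    sides-distinct {suc zero}       {zero}           eq = ⊥-elim (uw≢vw eq)
    sides-distinct {suc zero}       {suc zero}       _  = refl
    sides-distinct {suc zero}       {suc (suc zero)} eq = ⊥-elim (uv≢uw (sym eq))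
    sides-distinct {suc (suc zero)} {zero}           eq = ⊥-elim (uv≢vw eq)
    sides-distinct {suc (suc zero)} {suc zero}       eq = ⊥-elim (uv≢uw eq)
    sides-distinct {suc (suc zero)} {suc (suc zero)} _  = refl

  rainbow-or-gallai : (∃[ K ] Rainbow (inherited {H = complete 3} colouring K)) ⊎
    NoRainbowTriangle χ
  rainbow-or-gallai with Fin.any? (λ u → Fin.any? λ v → Fin.any? λ w →
    ¬? (χ u v ℕ.≟ χ u w) ×-dec ¬? (χ u v ℕ.≟ χ v w) ×-dec ¬? (χ u w ℕ.≟ χ v w))
  ... | yes (u , v , w , rainbow) = inj₁ (rainbow-copy {u} {v} {w} rainbow)
  ... | no none = inj₂ gallai
    where
    gallai : NoRainbowTriangle χ
    gallai u v w with χ u v ℕ.≟ χ u w | χ u v ℕ.≟ χ v w | χ u w ℕ.≟ χ v w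
    ... | yes p | _     | _     = inj₁ p
    ... | no _  | yes p | _     = inj₂ (inj₁ p)
    ... | no _  | no _  | yes p = inj₂ (inj₂ p)
    ... | no p  | no q  | no r  = ⊥-elim (none (u , v , w , p , q , r))

GallaiBound : ℕ → ℕ → Set
GallaiBound s N = ∀ {n} (χ : Fin n → Fin n → ℕ) → (∀ x y → χ x y ≡ χ y x) →
  NoRainbowTriangle χ → Ordering.Bound χ s N

bound⇒forces : ∀ {s N} → GallaiBound s N → Forces (suc s) 3 (suc N)
bound⇒forces {s} {N} bound k colouring with Colouring.rainbow-or-gallai colouring
... | inj₁ rainbow = inj₂ rainbow
-- The existence of an ordering is decided by exhaustive search; if there is none, the list of all
-- `N + 1` vertices violates the bound.
... | inj₂ gallai with ∃Vec? (suc s) (ordered? (Colouring.χ colouring) ∘ toList)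
...   | yes (xs , o) = inj₁ (Colouring.orderable-copy colouring xs o)
...   | no none = ⊥-elim (<⇒≱ (n<1+n N) (≤-trans
  (≤-reflexive (sym (length-tabulate {n = suc N} id)))
  (bound χ χ-sym gallai (Unique.allFin⁺ (suc N)) λ (xs , o , len , _) →
    let v , v≡xs = list⇒vec xs len in
    none (v , subst (Ordering.Ordered χ) (sym v≡xs) o))))
  where open Colouring colouring

-- Lower bound: iterated blow-ups of the pentagon.

record Construction (n k M : ℕ) : Set where
  field
    χ       : Fin n → Fin n → ℕ
    χ<k     : ∀ x y → χ x y < k
    χ-sym   : ∀ x y → χ x y ≡ χ y x
    gallai  : NoRainbowTriangle χ
    bounded : ∀ {xs} → Ordering.Ordered χ xs → length xs ≤ M

-- If `m ≤ n`, restrict the colouring to `m` vertices: an orderable copy would be an ordering of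
-- length `M + 1`, and a rainbow triangle would contradict `gallai`.
construction⇒lower-bound : ∀ {n k M m} → Construction n k M → Forces (suc M) 3 m → suc n ≤ m
construction⇒lower-bound {n} {k} {M} {m} C forces = ≰⇒> λ m≤n → absurd m≤n
  where
  open Construction C

  module _ (m≤n : m ≤ n) where
    ι : Fin m → Fin n
    ι i = inject≤ i m≤n

    ι-injective : ∀ {i j} → ι i ≡ ι j → i ≡ j
    ι-injective = Fin.inject≤-injective m≤n m≤n _ _

    colouring : EdgeColoring (complete m) (Fin k)
    colouring = record
      { color      = λ {u} {v} _ → fromℕ< (χ<k (ι u) (ι v))
      ; undirected = λ {u} {v} _ _ → Fin.fromℕ<-cong _ _ (χ-sym (ι u) (ι v)) _ _
      }

    absurd : ⊥
    absurd with forces k colouring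
    ... | inj₁ (K , v , c , spoke) = <⇒≱ (n<1+n M)
      (≤-trans (≤-reflexive (sym (length-tabulate f)))
        (bounded (tabulate-ordered f distinct λ i<j i<k →
          trans (edge i<j) (sym (edge i<k)))))
      where
      open Copy K

      f : Fin (suc M) → Fin n
      f i = ι (Injection.to embed (v ⟨$⟩ʳ i))

      v-injective : ∀ {i j} → v ⟨$⟩ʳ i ≡ v ⟨$⟩ʳ j → i ≡ j
      v-injective {i} {j} eq = trans (sym (Inverse.strictlyInverseʳ v i))
        (trans (cong (Inverse.from v) eq) (Inverse.strictlyInverseʳ v j))

      v-distinct : ∀ {i j} → i Fin.< j → v ⟨$⟩ʳ i ≢ v ⟨$⟩ʳ j
      v-distinct i<j eq = Fin.<⇒≢ i<j (v-injective eq)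

      distinct : ∀ {i j} → i Fin.< j → f i ≢ f j
      distinct i<j eq = v-distinct i<j (Injection.injective embed (ι-injective eq))

      edge : ∀ {i j} (i<j : i Fin.< j) → χ (f i) (f j) ≡ toℕ (lookup c (position i<j))
      edge i<j = trans (sym (Fin.toℕ-fromℕ< (χ<k _ _))) (cong toℕ (spoke i<j (v-distinct i<j)))
    ... | inj₂ (K , rainbow) with gallai (f zero) (f (suc zero)) (f (suc (suc zero)))
      where
      f : Fin 3 → Fin n
      f i = ι (Injection.to (Copy.embed K) i)
    ...   | inj₁ eq = rainbow {zero} {suc zero} {zero} {suc (suc zero)} (λ ()) (λ ())
      (λ { (inj₁ (_ , ())) ; (inj₂ (() , _)) }) (Fin.fromℕ<-cong _ _ eq _ _)
    ...   | inj₂ (inj₁ eq) = rainbow {zero} {suc zero} {suc zero} {suc (suc zero)} (λ ()) (λ ())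
      (λ { (inj₁ (() , _)) ; (inj₂ (() , _)) }) (Fin.fromℕ<-cong _ _ eq _ _)
    ...   | inj₂ (inj₂ eq) = rainbow {zero} {suc (suc zero)} {suc zero} {suc (suc zero)}
      (λ ()) (λ ()) (λ { (inj₁ (() , _)) ; (inj₂ (() , _)) }) (Fin.fromℕ<-cong _ _ eq _ _)

point : Construction 1 1 1
point = record
  { χ       = λ _ _ → 0
  ; χ<k     = λ _ _ → s≤s z≤n
  ; χ-sym   = λ _ _ → refl
  ; gallai  = λ _ _ _ → inj₁ refl
  ; bounded = bounded
  }
  where
  open Ordering {Fin 1} (λ _ _ → 0)

  bounded : ∀ {xs} → Ordered xs → length xs ≤ 1
  bounded []       = z≤n
  bounded (_ ∷ []) = s≤s z≤n
  bounded {zero ∷ zero ∷ _} (((x≢y , _) ∷ _) ∷ _) = ⊥-elim (x≢y refl)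

segment : Construction 2 1 2
segment = record
  { χ       = λ _ _ → 0
  ; χ<k     = λ _ _ → s≤s z≤n
  ; χ-sym   = λ _ _ → refl
  ; gallai  = λ _ _ _ → inj₁ refl
  ; bounded = bounded
  }
  where
  open Ordering {Fin 2} (λ _ _ → 0)

  pigeonhole : ∀ {x y z : Fin 2} → x ≢ y → x ≢ z → y ≢ z → ⊥
  pigeonhole {zero}     {zero}     {_}        x≢y _ _ = x≢y refl
  pigeonhole {zero}     {suc zero} {zero}     _ x≢z _ = x≢z refl
  pigeonhole {zero}     {suc zero} {suc zero} _ _ y≢z = y≢z refl
  pigeonhole {suc zero} {zero}     {zero}     _ _ y≢z = y≢z refl
  pigeonhole {suc zero} {zero}     {suc zero} _ x≢z _ = x≢z refl
  pigeonhole {suc zero} {suc zero} {_}        x≢y _ _ = x≢y refl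

  bounded : ∀ {xs} → Ordered xs → length xs ≤ 2
  bounded []           = z≤n
  bounded (_ ∷ [])     = s≤s z≤n
  bounded (_ ∷ _ ∷ []) = s≤s (s≤s z≤n)
  bounded (((x≢y , _) ∷ (x≢z , _) ∷ _) ∷ ((y≢z , _) ∷ _) ∷ _ ∷ _) =
    ⊥-elim (pigeonhole x≢y x≢z y≢z)

-- Differences 1 and 4 are the sides of the pentagon and 2 and 3 its diagonals, so each colour class
-- is a 5-cycle. The value at difference 0 is a default.
pentagon : Fin 5 → Fin 5 → ℕ
pentagon i j = side ∣ toℕ i - toℕ j ∣
  where
  side : ℕ → ℕ
  side 1 = 0
  side 4 = 0
  side _ = 1

pentagon-sym : ∀ i j → pentagon i j ≡ pentagon j i
pentagon-sym = from-yes (Fin.all? λ i → Fin.all? λ j → pentagon i j ℕ.≟ pentagon j i)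

pentagon<2 : ∀ i j → pentagon i j < 2
pentagon<2 = from-yes (Fin.all? λ i → Fin.all? λ j → pentagon i j <? 2)

pentagon-gallai : NoRainbowTriangle pentagon
pentagon-gallai = from-yes (Fin.all? λ i → Fin.all? λ j → Fin.all? λ k →
  (pentagon i j ℕ.≟ pentagon i k) ⊎-dec (pentagon i j ℕ.≟ pentagon j k) ⊎-dec
  (pentagon i k ℕ.≟ pentagon j k))

-- In a 5-cycle `i` has two neighbours; `j` is one of them, so `k` and `l` are both the other.
pentagon-2-regular : ∀ i j k l → i ≢ j → i ≢ k → i ≢ l → j ≢ k → j ≢ l →
  pentagon i j ≡ pentagon i k → pentagon i j ≡ pentagon i l → k ≡ l
pentagon-2-regular = from-yes (Fin.all? λ i → Fin.all? λ j → Fin.all? λ k → Fin.all? λ l →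
  ¬? (i Fin.≟ j) →-dec ¬? (i Fin.≟ k) →-dec ¬? (i Fin.≟ l) →-dec
  ¬? (j Fin.≟ k) →-dec ¬? (j Fin.≟ l) →-dec
  (pentagon i j ℕ.≟ pentagon i k) →-dec (pentagon i j ℕ.≟ pentagon i l) →-dec (k Fin.≟ l))

module BlowUp {n k M : ℕ} (C : Construction n k M) where
  open Construction C renaming (χ to χ₀; χ-sym to χ₀-sym; gallai to gallai₀; bounded to bounded₀)

  block : Fin (5 * n) → Fin 5
  block x = proj₁ (remQuot {5} n x)

  inner : Fin (5 * n) → Fin n
  inner x = proj₂ (remQuot {5} n x)

  block-inner-injective : ∀ {x y} → block x ≡ block y → inner x ≡ inner y → x ≡ y
  block-inner-injective {x} {y} p q = trans (sym (Fin.combine-remQuot {5} n x))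
    (trans (cong₂ combine p q) (Fin.combine-remQuot {5} n y))

  χ : Fin (5 * n) → Fin (5 * n) → ℕ
  χ x y with block x Fin.≟ block y
  -- The shift by 2 keeps inner colours apart from the pentagon colours 0 and 1, so a colour reveals
  -- whether its edge stays inside a block.
  ... | yes _ = 2 + χ₀ (inner x) (inner y)
  ... | no _  = pentagon (block x) (block y)

  χ-inner : ∀ {x y} → block x ≡ block y → χ x y ≡ 2 + χ₀ (inner x) (inner y)
  χ-inner {x} {y} eq with block x Fin.≟ block y
  ... | yes _ = refl
  ... | no ≢  = ⊥-elim (≢ eq)

  χ-outer : ∀ {x y} → block x ≢ block y → χ x y ≡ pentagon (block x) (block y)
  χ-outer {x} {y} ≢ with block x Fin.≟ block y
  ... | yes eq = ⊥-elim (≢ eq)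
  ... | no _   = refl

  χ<2+k : ∀ x y → χ x y < 2 + k
  χ<2+k x y with block x Fin.≟ block y
  ... | yes _ = s≤s (s≤s (χ<k (inner x) (inner y)))
  ... | no _  = ≤-trans (pentagon<2 (block x) (block y)) (m≤m+n 2 k)

  χ-sym : ∀ x y → χ x y ≡ χ y x
  χ-sym x y with block x Fin.≟ block y
  ... | yes eq = trans (cong (2 +_) (χ₀-sym (inner x) (inner y))) (sym (χ-inner (sym eq)))
  ... | no ≢   = trans (pentagon-sym (block x) (block y)) (sym (χ-outer (≢-sym ≢)))

  -- Two vertices of one block see a vertex outside it in the same colour. Triangles within a block
  -- or across three blocks are inherited from `χ₀` or the pentagon.
  gallai : NoRainbowTriangle χ
  gallai x y z = cases (block x Fin.≟ block y) (block x Fin.≟ block z) (block y Fin.≟ block z)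
    where
    cases : Dec (block x ≡ block y) → Dec (block x ≡ block z) → Dec (block y ≡ block z) →
      χ x y ≡ χ x z ⊎ χ x y ≡ χ y z ⊎ χ x z ≡ χ y z
    cases (yes p) (yes q) _ rewrite χ-inner p | χ-inner q | χ-inner (trans (sym p) q)
      with gallai₀ (inner x) (inner y) (inner z)
    ... | inj₁ eq        = inj₁ (cong (2 +_) eq)
    ... | inj₂ (inj₁ eq) = inj₂ (inj₁ (cong (2 +_) eq))
    ... | inj₂ (inj₂ eq) = inj₂ (inj₂ (cong (2 +_) eq))
    cases (yes p) (no q) _ = inj₂ (inj₂ (trans (χ-outer q)
      (trans (cong (λ b → pentagon b (block z)) p) (sym (χ-outer (q ∘ trans p))))))
    cases (no p) (yes q) _ = inj₂ (inj₁ (trans (χ-sym x y) (trans (χ-outer (≢-sym p))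
      (trans (cong (pentagon (block y)) q) (sym (χ-outer (p ∘ λ r → trans q (sym r))))))))
    cases (no p) (no q) (yes r) = inj₁ (trans (χ-outer p)
      (trans (cong (pentagon (block x)) r) (sym (χ-outer q))))
    cases (no p) (no q) (no r) rewrite χ-outer p | χ-outer q | χ-outer r =
      pentagon-gallai (block x) (block y) (block z)

  open Ordering using (Ordered; []; _∷_)

  2≤χ⇒same-block : ∀ {x y} → 2 ≤ χ x y → block x ≡ block y
  2≤χ⇒same-block {x} {y} 2≤χ with block x Fin.≟ block y
  ... | yes eq = eq
  ... | no _   = ⊥-elim (<⇒≱ (pentagon<2 (block x) (block y)) 2≤χ)

  χ<2⇒other-block : ∀ {x y} → χ x y < 2 → block x ≢ block y
  χ<2⇒other-block χ<2 eq = <⇒≱ χ<2 (≤-trans (m≤m+n 2 _) (≤-reflexive (sym (χ-inner eq))))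

  inner-ordered : ∀ {b xs} → All (λ x → block x ≡ b) xs → Ordered χ xs → Ordered χ₀ (map inner xs)
  inner-ordered [] [] = []
  inner-ordered (refl ∷ bs) (all ∷ o) =
    All.map⁺ (All.zipWith (λ (eq , x≢y , c) →
      (λ i → x≢y (block-inner-injective (sym eq) i)) ,
      cong (pred ∘ pred) (trans (sym (χ-inner (sym eq))) c)) (bs , all)) ∷
    inner-ordered bs o

  block-bounded : ∀ {b xs} → All (λ x → block x ≡ b) xs → Ordered χ xs → length xs ≤ M
  block-bounded {xs = xs} bs o =
    ≤-trans (≤-reflexive (sym (length-map inner xs))) (bounded₀ (inner-ordered bs o))

  head-block-bounded : ∀ {x c xs} → All (λ y → x ≢ y × χ x y ≡ c) xs → 2 ≤ c →
    Ordered χ (x ∷ xs) → length (x ∷ xs) ≤ M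
  head-block-bounded all 2≤c = block-bounded
    (refl ∷ All.map (λ { (_ , refl) → sym (2≤χ⇒same-block 2≤c) }) all)

  -- Two vertices joined to the rest by pentagon colours confine the rest to a
  -- single block.
  bounded : ∀ {xs} → Ordered χ xs → length xs ≤ 2 + M
  bounded [] = z≤n
  bounded {x ∷ xs} (_∷_ {c = c} all o) with 2 ≤? c
  -- An inner colour at the first vertex keeps the entire ordering in one block.
  ... | yes 2≤c = ≤-trans (head-block-bounded all 2≤c (all ∷ o)) (m≤n+m M 2)
  bounded {x ∷ []} _ | no _ = s≤s z≤n
  bounded {x ∷ y ∷ ys} (((_ , refl) ∷ all) ∷ (_∷_ {c = d} all′ o)) | no 2≰c with 2 ≤? d
  ... | yes 2≤d = s≤s (≤-trans (head-block-bounded all′ 2≤d (all′ ∷ o)) (n≤1+n M))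
  bounded {x ∷ y ∷ []} _ | no _ | no _ = s≤s (s≤s z≤n)
  bounded {x ∷ y ∷ z ∷ zs} (((_ , refl) ∷ all) ∷ (all′ ∷ o)) | no 2≰c | no 2≰d =
    s≤s (s≤s (block-bounded (All.zipWith same-block (all , all′)) o))
    where
    x|y : block x ≢ block y
    x|y = χ<2⇒other-block (≰⇒> 2≰c)

    same-block : ∀ {w} → (x ≢ w × χ x w ≡ χ x y) × (y ≢ w × χ y w ≡ _) → block w ≡ block z
    same-block {w} ((_ , xw) , (_ , yw)) with All.head all | All.head all′
    ... | _ , xz | _ , yz =
      -- The blocks of `y`, `w` and `z` are joined to that of `x` by one pentagon colour, and `w`
      -- and `z` avoid the block of `y`, so they share the one remaining block.
      pentagon-2-regular (block x) (block y) (block w) (block z) x|y x|w x|z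
        (χ<2⇒other-block (≤-trans (s≤s (≤-reflexive yw)) (≰⇒> 2≰d)))
        (χ<2⇒other-block (≤-trans (s≤s (≤-reflexive yz)) (≰⇒> 2≰d)))
        (trans (sym (χ-outer x|y)) (trans (sym xw) (χ-outer x|w)))
        (trans (sym (χ-outer x|y)) (trans (sym xz) (χ-outer x|z)))
      where
      x|w : block x ≢ block w
      x|w = χ<2⇒other-block (≤-trans (s≤s (≤-reflexive xw)) (≰⇒> 2≰c))
      x|z : block x ≢ block z
      x|z = χ<2⇒other-block (≤-trans (s≤s (≤-reflexive xz)) (≰⇒> 2≰c))

  blow-up : Construction (5 * n) (2 + k) (2 + M)
  blow-up = record
    { χ = χ ; χ<k = χ<2+k ; χ-sym = χ-sym ; gallai = gallai ; bounded = bounded }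

iterate : ∀ {n k M} → Construction n k M → ∀ t → ∃[ k′ ] Construction (n * 5 ^ t) k′ (t * 2 + M)
iterate {n} {k} {M} C zero = k , subst (λ N → Construction N k M) (sym (*-identityʳ n)) C
iterate {n} {k} {M} C (suc t) with iterate C t
... | k′ , C′ = 2 + k′ , subst (λ N → Construction N (2 + k′) (2 + (t * 2 + M)))
    (lemma n (5 ^ t)) (BlowUp.blow-up C′)
  where
  lemma : ∀ n q → 5 * (n * q) ≡ n * (5 * q)
  lemma = solve-∀

-- Exact values for odd and even `s`.

isCR : ∀ {s k N} → GallaiBound s N → Construction N k s → IsCR (suc s) 3 (N + 1)
isCR {s} {k} {N} bound C = subst (IsCR (suc s) 3) (+-comm 1 N)
  (bound⇒forces bound , λ m → construction⇒lower-bound C)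

-- Blow-ups of a single edge attain `bound₂`; in the even case, blow-ups of a single vertex attain
-- `bound₁`.
odd-CR : ∀ t → IsCR (3 + t * 2) 3 (2 * 5 ^ t + 1)
odd-CR t with iterate segment t
... | k , C = isCR bound (subst (Construction (2 * 5 ^ t) k) (+-comm (t * 2) 2) C)
  where
  bound : GallaiBound (2 + t * 2) (2 * 5 ^ t)
  bound χ χ-sym gallai {S} = subst (λ N → Ordering.Bound χ (2 + t * 2) N) (lemma (5 ^ t))
    (Upper.Bounds.bound₂ (Upper.bounds Fin._≟_ χ χ-sym gallai t)) {S}
    where
    lemma : ∀ q → q + q ≡ 2 * q
    lemma = solve-∀

even-CR : ∀ t → IsCR (2 + t * 2) 3 (5 ^ t + 1)
even-CR t with iterate point t
... | k , C = isCR bound (subst (λ N → Construction N k (1 + t * 2)) (*-identityˡ (5 ^ t))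
    (subst (Construction (1 * 5 ^ t) k) (+-comm (t * 2) 1) C))
  where
  bound : GallaiBound (1 + t * 2) (5 ^ t)
  bound χ χ-sym gallai = Upper.Bounds.bound₁ (Upper.bounds Fin._≟_ χ χ-sym gallai t)

2∤3+n⇒2∣n : ∀ n → 2 ∤ 3 + n → 2 ∣ n
2∤3+n⇒2∣n n odd with n % 2 in eq | m%n<n n 2 | m≡m%n+[m/n]*n n 2
... | 0 | _ | n≡ = divides (n / 2) n≡
... | 1 | _ | n≡ = ⊥-elim (odd (divides (2 + n / 2) (cong (3 +_) n≡)))
... | suc (suc _) | s≤s (s≤s ()) | _

half : ∀ n → 2 ∣ n → n ≡ n / 2 * 2
half n 2∣n = trans (m≡m%n+[m/n]*n n 2) (cong (_+ n / 2 * 2) (n∣m⇒m%n≡0 n 2 2∣n))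

theorem1p5 : (s : ℕ) → 3 ≤ s →
    (2 ∤ s → IsCR s 3 (2 * 5 ^ ((s ∸ 3) / 2) + 1)) ×
    (2 ∣ s → IsCR s 3 (5 ^ ((s ∸ 2) / 2) + 1))
theorem1p5 (suc (suc (suc n))) (s≤s (s≤s (s≤s z≤n))) =
  -- With `s = 3 + n`, odd `s` makes `n` even, whereas even `s` is read as `2 + suc n` with `suc n`
  -- even.
  (λ odd → subst (λ u → IsCR (3 + u) 3 (2 * 5 ^ (n / 2) + 1))
    (sym (half n (2∤3+n⇒2∣n n odd))) (odd-CR (n / 2))) ,
  (λ even → subst (λ u → IsCR (2 + u) 3 (5 ^ (suc n / 2) + 1))
    (sym (half (suc n) (∣m+n∣m⇒∣n even ∣-refl))) (even-CR (suc n / 2)))
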